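{- $\hat{\mathcal S}_\alpha(x_1, \ldots , x_n) = \mathcal S_\beta(x_1, \ldots , x_n)$ if and only if $\alpha=\beta$ and either $\alpha$ has all parts the same, or all parts of $\alpha$ are $1$ or $2$, or $n=\ell(\alpha)$ and consecutive parts of $\alpha$ differ by at most $1$.
   Context: $\alpha,\beta$ are compositions with at most $n$ parts. $\mathcal S_\alpha(x_1,\ldots,x_n)$ is the quasisymmetric Schur polynomial of Haglund–Luoto–Mason–van Willigenburg: the generating function of fillings of the composition diagram of $\alpha$ (French notation, row $i$ has $\alpha_i$ left-justified boxes) with entries in $\{1,\ldots,n\}$ such that rows weakly decrease left to right, the first column strictly increases bottom to top, and every triple is an inversion triple. Here a type A triple is boxes $z,x$ adjacent in a row ($z$ left) and $y$ above $x$ in a higher row, with the lower row weakly longer; a type B triple is $z,x$ adjacent in a row and $y$ below $z$ in a lower row, with the higher row strictly longer; a triple is an inversion triple unless $z\ge y\ge x$. The Young quasisymmetric Schur polynomial is $\hat{\mathcal S}_\alpha(x_1,\ldots,x_n)=\mathcal S_{\mathrm{rev}(\alpha)}(x_n,\ldots,x_1)$, where $\mathrm{rev}(\alpha)$ is $\alpha$ reversed. -}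

module Defs where

open import Data.Nat using (ℕ; zero; suc; _+_; _≤_; _<_; _≤ᵇ_; _<ᵇ_; _≡ᵇ_)
open import Data.Bool using (Bool; true; false; _∧_; _∨_; not; if_then_else_)
open import Data.List using (List; []; _∷_; length; map; concatMap; upTo; reverse)
open import Data.List.Relation.Unary.All using (All)
open import Data.List.Relation.Unary.Linked using (Linked)
open import Data.List.Membership.Propositional using (_∈_)
open import Data.Vec using (Vec; toList)
import Data.Vec as Vec
open import Relation.Binary.PropositionalEquality using (_≡_)
open import Data.Product using (_×_)

IsComposition : List ℕ → Set
IsComposition α = All (λ p → 0 < p) α

AllPartsSame : List ℕ → Set
AllPartsSame α = ∀ {p q} → p ∈ α → q ∈ α → p ≡ q

data OneOrTwo : ℕ → Set where
  is1 : OneOrTwo 1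
  is2 : OneOrTwo 2

AllPartsOneOrTwo : List ℕ → Set
AllPartsOneOrTwo α = All OneOrTwo α

DiffAtMostOne : ℕ → ℕ → Set
DiffAtMostOne a b = (a ≤ b + 1) × (b ≤ a + 1)

ConsecutiveDiffAtMostOne : List ℕ → Set
ConsecutiveDiffAtMostOne α = Linked DiffAtMostOne α

at : List ℕ → ℕ → ℕ
at []       _       = 0
at (x ∷ xs) zero    = x
at (x ∷ xs) (suc i) = at xs i

row : List (List ℕ) → ℕ → List ℕ
row []       _       = []
row (r ∷ rs) zero    = r
row (r ∷ rs) (suc i) = row rs i

count : {A : Set} → (A → Bool) → List A → ℕ
count p []       = 0
count p (x ∷ xs) = if p x then suc (count p xs) else count p xs

eqListᵇ : List ℕ → List ℕ → Bool
eqListᵇ []       []       = true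
eqListᵇ (x ∷ xs) (y ∷ ys) = (x ≡ᵇ y) ∧ eqListᵇ xs ys
eqListᵇ _        _        = false

allBelow : ℕ → (ℕ → Bool) → Bool
allBelow zero    f = true
allBelow (suc m) f = allBelow m f ∧ f m

-- Fillings of the composition diagram of α with entries in {1,…,n}.
-- A filling is a list of rows; row i (0-based, i = 0 is the BOTTOM row,
-- French notation) is the list of its entries from left to right.
-- T(i,j) = entry in row i, column j (both 0-based).

values : ℕ → List ℕ
values n = map suc (upTo n)

wordsOfLength : ℕ → ℕ → List (List ℕ)
wordsOfLength n zero    = [] ∷ []
wordsOfLength n (suc k) = concatMap (λ v → map (v ∷_) (wordsOfLength n k)) (values n)

allFillings : List ℕ → ℕ → List (List (List ℕ))
allFillings []      n = [] ∷ []
allFillings (a ∷ α) n =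
  concatMap (λ r → map (r ∷_) (allFillings α n)) (wordsOfLength n a)

entry : List (List ℕ) → ℕ → ℕ → ℕ
entry T i j = at (row T i) j

inversionᵇ : ℕ → ℕ → ℕ → Bool
inversionᵇ z y x = not ((y ≤ᵇ z) ∧ (x ≤ᵇ y))

module _ (α : List ℕ) (T : List (List ℕ)) where
  private
    ℓ = length α
    len = at α

  rowsWeaklyDecreaseᵇ : Bool
  rowsWeaklyDecreaseᵇ =
    allBelow ℓ λ i → allBelow (len i) λ j →
      if suc j <ᵇ len i then entry T i (suc j) ≤ᵇ entry T i j else true

  firstColumnIncreasesᵇ : Bool
  firstColumnIncreasesᵇ =
    allBelow ℓ λ i →
      if suc i <ᵇ ℓ then entry T i 0 <ᵇ entry T (suc i) 0 else true

  typeAOKᵇ : Bool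
  typeAOKᵇ =
    allBelow ℓ λ i → allBelow ℓ λ i' → allBelow (len i) λ k →
      if (i <ᵇ i') ∧ (len i' ≤ᵇ len i) ∧ (suc k <ᵇ len i) ∧ (suc k <ᵇ len i')
      then inversionᵇ (entry T i k) (entry T i' (suc k)) (entry T i (suc k))
      else true

  typeBOKᵇ : Bool
  typeBOKᵇ =
    allBelow ℓ λ i → allBelow ℓ λ i' → allBelow (len i') λ k →
      if (i <ᵇ i') ∧ (len i <ᵇ len i') ∧ (k <ᵇ len i) ∧ (suc k <ᵇ len i')
      then inversionᵇ (entry T i' k) (entry T i k) (entry T i' (suc k))
      else true

  validFillingᵇ : Bool
  validFillingᵇ = rowsWeaklyDecreaseᵇ ∧ firstColumnIncreasesᵇ ∧ typeAOKᵇ ∧ typeBOKᵇ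

content : ℕ → List (List ℕ) → List ℕ
content n T = map (λ v → count (λ r → v ≡ᵇ r) (concatMap (λ r → r) T)) (values n)

-- Polynomials in x₁,…,xₙ with ℕ coefficients are represented by their
-- coefficient functions  Vec ℕ n → ℕ  (exponent vector ↦ coefficient).

QS : List ℕ → (n : ℕ) → Vec ℕ n → ℕ
QS α n e = count (λ T → validFillingᵇ α T ∧ eqListᵇ (content n T) (toList e))
                 (allFillings α n)

-- Young quasisymmetric Schur polynomial Ŝ_α(x₁,…,xₙ) = S_rev(α)(xₙ,…,x₁):
-- substituting xᵢ ↦ x_{n+1-i} reverses exponent vectors.
YQS : List ℕ → (n : ℕ) → Vec ℕ n → ℕ
YQS α n e = QS (reverse α) n (Vec.reverse e)

_≈ₚ_ : {n : ℕ} → (Vec ℕ n → ℕ) → (Vec ℕ n → ℕ) → Set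
f ≈ₚ g = ∀ e → f e ≡ g e

{-# OPTIONS --safe #-}
module Submission where

-- Coefficients count fillings, so Ŝ_α = S_β says that the fillings of β and those of rev α
-- with complementary contents (v ↔ n + 1 − v) are equinumerous.
--
-- Equal entries of a filling lie in distinct columns, so Σ_v C(#v , 2) is at most the same sum over
-- the row lengths. Applied to the partners of the two fillings with constant rows 1, 2, …, this bound
-- is attained; then the columns are nested sets, the triple conditions make all rows constant,
-- and α = β. If α violates the conditions on its parts, a filling of α or of rev α with constant rows
-- except for one lowered entry has no partner of complementary content.
--
-- Conversely, if n = ℓ(α) and ascents are at most 1, the only filling has constant rows 1, 2, …, n.
-- A filling of a rectangle is determined by its columns as sets, which can be complemented and
-- reversed in order. If all parts are 1 or 2, doubling the entries of the rows of length 1 reduces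
-- to a rectangle with two columns.

open import Defs
open import Data.Nat using (ℕ; _≤_)
open import Data.List using (List; length)
open import Data.Product using (_×_)
open import Data.Sum using (_⊎_)
open import Function.Bundles using (_⇔_)
open import Relation.Binary.PropositionalEquality using (_≡_)

open import Data.Bool using (Bool; true; false; _∧_; not; if_then_else_; T)
open import Data.Bool.Properties using (∧-zeroʳ; T-≡)
open import Data.Nat using (zero; suc; _+_; _*_; _∸_; _<_; z≤n; s≤s; z<s; s<s; s≤s⁻¹; _≟_; _≤?_; _<?_; _≤ᵇ_; _<ᵇ_; _≡ᵇ_)
open import Data.Nat.Properties
open import Algebra.Properties.CommutativeSemigroup +-commutativeSemigroup using (interchange)
open import Data.List using ([]; _∷_; _++_; [_]; map; concatMap; applyUpTo; reverse; cartesianProductWith)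
open import Data.List.Properties using (length-applyUpTo; length-reverse; reverse-involutive; unfold-reverse; map-applyUpTo; ∷-injective)
open import Data.List.Membership.Propositional using (_∈_)
open import Data.List.Membership.Propositional.Properties using (∈-map⁺; ∈-map⁻; ∈-applyUpTo⁺; ∈-applyUpTo⁻; ∈-cartesianProductWith⁺; ∈-cartesianProductWith⁻; ∈-∃++; ∈-++⁺ˡ; ∈-++⁺ʳ; ∈-++⁻)
open import Data.List.Relation.Unary.Any using (here; there)
open import Data.List.Relation.Unary.All using (All; []; _∷_)
import Data.List.Relation.Unary.All as All
import Data.List.Relation.Unary.All.Properties as AllP
open import Data.List.Relation.Unary.AllPairs using (AllPairs; []; _∷_)
open import Data.List.Relation.Unary.Linked using (Linked; []; [-]; _∷_)
open import Data.List.Relation.Unary.Unique.Propositional using (Unique)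
import Data.List.Relation.Unary.Unique.Propositional.Properties as UniqueP
open import Data.List.Relation.Binary.Permutation.Propositional using (_↭_; ↭-refl; ↭-sym; ↭-trans; ↭-reflexive; prep; swap)
import Data.List.Relation.Binary.Permutation.Propositional.Properties as ↭P
open import Data.List.Sort ≤-decTotalOrder using (sort; sort-↭; sort-↗)
open import Data.List.Relation.Unary.Linked.Properties using (Linked⇒AllPairs)
import Data.List.Relation.Unary.AllPairs as AllPairs
import Data.List.Relation.Unary.AllPairs.Properties as AllPairsP
import Data.List.Relation.Binary.Permutation.Setoid.Properties as ↭SetoidP
open import Data.List.Relation.Binary.Permutation.Propositional using (↭⇒↭ₛ)
open import Data.Nat.ListAction using (sum)
open import Data.Nat.ListAction.Properties using (sum-↭)
open import Data.Vec using (Vec; toList)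
import Data.Vec as Vec
import Data.Vec.Properties as VecP
open import Data.Product using (∃; _,_; proj₁; proj₂)
open import Data.Sum using (inj₁; inj₂; [_,_]′)
import Data.Sum as Sum
import Data.Product as Product
open import Data.Unit using (⊤; tt)
open import Function using (_∘_; id)
open import Function.Bundles using (mk⇔; Equivalence)
open import Relation.Nullary using (¬_; Dec; yes; no; contradiction)
open import Relation.Binary.Definitions using (tri<; tri≈; tri>)
open import Relation.Nullary.Decidable using (does; dec-true; dec-false)
open import Relation.Binary.PropositionalEquality using (_≢_; setoid; refl; sym; trans; cong; cong₂; subst; subst₂; module ≡-Reasoning)

-- Finite sums

-- Necessity uses only which coefficients are nonzero and is phrased through `Dual`: every filling
-- of one shape has a partner of complementary content in the other. Both directions matter: the
-- bounds for the two partners close up to a cycle of inequalities, hence of equalities. Sufficiency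
-- needs multiplicities; each admissible class of shapes is closed under reversal, so an injection
-- from fillings of α to fillings of rev α, used also for rev α, gives equality. For rectangles, the
-- complemented columns have to be rearranged so that the triple conditions hold. Given its left
-- neighbour, a column is arranged greedily from the bottom; the choice never gets stuck because of
-- a Hall condition on the numbers of entries ≥ t, which the decrease of rows supplies. In the case
-- of parts 1 and 2, doubling turns type B triples into the demand that second-column entries above
-- a doubled row exceed its value. This demand survives because a doubled row separates smaller
-- entries below from larger entries above, and complementing reverses the separation.

∑ : ℕ → (ℕ → ℕ) → ℕ
∑ zero    f = 0
∑ (suc n) f = f 0 + ∑ n (f ∘ suc)

𝟙 : {P : Set} → Dec P → ℕ
𝟙 P? = if does P? then 1 else 0

𝟙-yes : {P : Set} (P? : Dec P) → P → 𝟙 P? ≡ 1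
𝟙-yes P? p rewrite dec-true P? p = refl

𝟙-no : {P : Set} (P? : Dec P) → ¬ P → 𝟙 P? ≡ 0
𝟙-no P? ¬p rewrite dec-false P? ¬p = refl

𝟙≤1 : {P : Set} (P? : Dec P) → 𝟙 P? ≤ 1
𝟙≤1 (yes _) = ≤-refl
𝟙≤1 (no _)  = z≤n

𝟙-mono : {P Q : Set} (P? : Dec P) (Q? : Dec Q) → (P → Q) → 𝟙 P? ≤ 𝟙 Q?
𝟙-mono (yes p) Q? f = ≤-reflexive (sym (𝟙-yes Q? (f p)))
𝟙-mono (no _)  Q? f = z≤n

𝟙-cong : {P Q : Set} (P? : Dec P) (Q? : Dec Q) → (P → Q) → (Q → P) → 𝟙 P? ≡ 𝟙 Q?
𝟙-cong P? Q? f g = ≤-antisym (𝟙-mono P? Q? f) (𝟙-mono Q? P? g)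

𝟙-positive : {P : Set} (P? : Dec P) → 0 < 𝟙 P? → P
𝟙-positive (yes p) _ = p

𝟙*𝟙-positive : {P Q : Set} (P? : Dec P) (Q? : Dec Q) → 0 < 𝟙 P? * 𝟙 Q? → P × Q
𝟙*𝟙-positive (yes p) (yes q) _ = p , q

𝟙*-≤ : {P : Set} (P? : Dec P) {m k : ℕ} → (P → m ≤ k) → 𝟙 P? * m ≤ k
𝟙*-≤ (yes p) {m} h = ≤-trans (≤-reflexive (+-identityʳ m)) (h p)
𝟙*-≤ (no _)      h = z≤n

𝟙*-cong : {P : Set} (P? : Dec P) {m k : ℕ} → (P → m ≡ k) → 𝟙 P? * m ≡ 𝟙 P? * k
𝟙*-cong (yes p) h = cong (_+ 0) (h p)
𝟙*-cong (no _)  h = refl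

≤-𝟙* : {P : Set} (P? : Dec P) {m k : ℕ} → m ≤ k → (¬ P → m ≡ 0) → m ≤ 𝟙 P? * k
≤-𝟙* (yes _) {k = k} m≤k _ = ≤-trans m≤k (m≤m+n k 0)
≤-𝟙* (no ¬p) _ h = ≤-reflexive (h ¬p)

∑-cong : ∀ n {f g} → (∀ i → i < n → f i ≡ g i) → ∑ n f ≡ ∑ n g
∑-cong zero    h = refl
∑-cong (suc n) h = cong₂ _+_ (h 0 z<s) (∑-cong n (λ i i<n → h (suc i) (s<s i<n)))

∑-mono-≤ : ∀ n {f g} → (∀ i → i < n → f i ≤ g i) → ∑ n f ≤ ∑ n g
∑-mono-≤ zero    h = z≤n
∑-mono-≤ (suc n) h = +-mono-≤ (h 0 z<s) (∑-mono-≤ n (λ i i<n → h (suc i) (s<s i<n)))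

∑-mono-< : ∀ n {f g} j → j < n → f j < g j → (∀ i → i < n → f i ≤ g i) → ∑ n f < ∑ n g
∑-mono-< (suc n) zero    _     fj<gj h = +-mono-<-≤ fj<gj (∑-mono-≤ n (λ i i<n → h (suc i) (s<s i<n)))
∑-mono-< (suc n) (suc j) sj<sn fj<gj h =
  +-mono-≤-< (h 0 z<s) (∑-mono-< n j (s≤s⁻¹ sj<sn) fj<gj (λ i i<n → h (suc i) (s<s i<n)))

∑-zero : ∀ n {f} → (∀ i → i < n → f i ≡ 0) → ∑ n f ≡ 0
∑-zero zero    h = refl
∑-zero (suc n) h = cong₂ _+_ (h 0 z<s) (∑-zero n (λ i i<n → h (suc i) (s<s i<n)))

∑-+ : ∀ n f g → ∑ n (λ i → f i + g i) ≡ ∑ n f + ∑ n g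
∑-+ zero    f g = refl
∑-+ (suc n) f g = trans (cong (f 0 + g 0 +_) (∑-+ n (f ∘ suc) (g ∘ suc)))
                        (interchange (f 0) (g 0) _ _)

∑-*ˡ : ∀ n c f → ∑ n (λ i → c * f i) ≡ c * ∑ n f
∑-*ˡ zero    c f = sym (*-zeroʳ c)
∑-*ˡ (suc n) c f = trans (cong (c * f 0 +_) (∑-*ˡ n c (f ∘ suc))) (sym (*-distribˡ-+ c (f 0) _))

∑-comm : ∀ m n (f : ℕ → ℕ → ℕ) → ∑ m (λ i → ∑ n (f i)) ≡ ∑ n (λ j → ∑ m (λ i → f i j))
∑-comm zero    n f = sym (∑-zero n (λ _ _ → refl))
∑-comm (suc m) n f = trans (cong (∑ n (f 0) +_) (∑-comm m n (f ∘ suc))) (sym (∑-+ n (f 0) _))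

∑-const : ∀ n c → ∑ n (λ _ → c) ≡ n * c
∑-const zero    c = refl
∑-const (suc n) c = cong (c +_) (∑-const n c)

∑-last : ∀ n f → ∑ (suc n) f ≡ ∑ n f + f n
∑-last zero    f = +-identityʳ (f 0)
∑-last (suc n) f = trans (cong (f 0 +_) (∑-last n (f ∘ suc))) (sym (+-assoc (f 0) _ _))

∑-reverse : ∀ n {f g} → (∀ i j → suc (i + j) ≡ n → f i ≡ g j) → ∑ n f ≡ ∑ n g
∑-reverse zero            h = refl
∑-reverse (suc n) {f} {g} h = begin
  f 0 + ∑ n (f ∘ suc)   ≡⟨ cong₂ _+_ (h 0 n refl) (∑-reverse n (λ i j eq → h (suc i) j (cong suc eq))) ⟩
  g n + ∑ n g           ≡⟨ +-comm (g n) _ ⟩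
  ∑ n g + g n           ≡⟨ ∑-last n g ⟨
  ∑ (suc n) g           ∎
  where open ≡-Reasoning

term≤∑ : ∀ n f {i} → i < n → f i ≤ ∑ n f
term≤∑ (suc n) f {zero}  _     = m≤m+n _ _
term≤∑ (suc n) f {suc i} si<sn = ≤-trans (term≤∑ n (f ∘ suc) (s≤s⁻¹ si<sn)) (m≤n+m _ _)

∑-single : ∀ n f {i} → i < n → (∀ j → j < n → j ≢ i → f j ≡ 0) → ∑ n f ≡ f i
∑-single (suc n) f {zero} _ h =
  trans (cong (f 0 +_) (∑-zero n (λ j j<n → h (suc j) (s<s j<n) λ ()))) (+-identityʳ _)
∑-single (suc n) f {suc i} si<sn h =
  cong₂ _+_ (h 0 z<s λ ())
    (∑-single n (f ∘ suc) (s≤s⁻¹ si<sn) (λ j j<n j≢i → h (suc j) (s<s j<n) (j≢i ∘ suc-injective)))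

∑-positive : ∀ n f → 0 < ∑ n f → ∃ λ i → i < n × 0 < f i
∑-positive (suc n) f 0<∑ with f 0 in eq
... | suc _ = 0 , z<s , subst (0 <_) (sym eq) z<s
... | zero  with i , i<n , 0<fi ← ∑-positive n (f ∘ suc) 0<∑ = suc i , s<s i<n , 0<fi

∑≤n : ∀ n f → (∀ i → i < n → f i ≤ 1) → ∑ n f ≤ n
∑≤n n f h = ≤-trans (∑-mono-≤ n h) (≤-reflexive (trans (∑-const n 1) (*-identityʳ n)))

∑-mono-bound : ∀ {m n} f → m ≤ n → ∑ m f ≤ ∑ n f
∑-mono-bound {zero}          f _         = z≤n
∑-mono-bound {suc m} {suc n} f (s≤s m≤n) = +-monoʳ-≤ (f 0) (∑-mono-bound (f ∘ suc) m≤n)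

∑-restrict : ∀ {m n} f → m ≤ n → ∑ n (λ k → 𝟙 (k <? m) * f k) ≡ ∑ m f
∑-restrict {n = n} f z≤n = ∑-zero n (λ k _ → cong (_* f k) (𝟙-no (k <? 0) λ ()))
∑-restrict {suc m} {suc n} f (s≤s m≤n) =
  cong₂ _+_ (+-identityʳ (f 0))
    (trans (∑-cong n (λ k _ → cong (_* f (suc k)) (𝟙-cong (suc k <? suc m) (k <? m) s≤s⁻¹ s<s)))
           (∑-restrict (f ∘ suc) m≤n))

-- Fillings as functions of the (0-based) row and column

-- Values outside the diagram are arbitrary. Being an inversion triple, the negation of z ≥ y ≥ x,
-- is read as the implication y ≤ z → y < x.
record Filling (ℓ : ℕ) (a : ℕ → ℕ) (n : ℕ) (g : ℕ → ℕ → ℕ) : Set where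
  field
    positive : ∀ {r k} → r < ℓ → k < a r → 0 < g r k
    bounded  : ∀ {r k} → r < ℓ → k < a r → g r k ≤ n
    row-step : ∀ {r k} → r < ℓ → suc k < a r → g r (suc k) ≤ g r k
    col-step : ∀ {r} → suc r < ℓ → g r 0 < g (suc r) 0
    typeA    : ∀ {i i′ k} → i < i′ → i′ < ℓ → a i′ ≤ a i → suc k < a i′ →
               g i′ (suc k) ≤ g i k → g i′ (suc k) < g i (suc k)
    typeB    : ∀ {i i′ k} → i < i′ → i′ < ℓ → a i < a i′ → k < a i → suc k < a i′ →
               g i k ≤ g i′ k → g i k < g i′ (suc k)

cells : ℕ → (ℕ → ℕ) → (ℕ → ℕ → ℕ) → ℕ
cells ℓ a F = ∑ ℓ (λ r → ∑ (a r) (F r))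

occurrences : ℕ → (ℕ → ℕ) → (ℕ → ℕ → ℕ) → ℕ → ℕ
occurrences ℓ a g v = cells ℓ a (λ r k → 𝟙 (v ≟ g r k))

cells-cong : ∀ ℓ a {F G} → (∀ r k → r < ℓ → k < a r → F r k ≡ G r k) → cells ℓ a F ≡ cells ℓ a G
cells-cong ℓ a h = ∑-cong ℓ (λ r r<ℓ → ∑-cong (a r) (λ k k<a → h r k r<ℓ k<a))

term≤cells : ∀ ℓ a F {r k} → r < ℓ → k < a r → F r k ≤ cells ℓ a F
term≤cells ℓ a F r<ℓ k<a = ≤-trans (term≤∑ (a _) (F _) k<a) (term≤∑ ℓ _ r<ℓ)

cells-positive : ∀ ℓ a F → 0 < cells ℓ a F → ∃ λ r → ∃ λ k → r < ℓ × k < a r × 0 < F r k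
cells-positive ℓ a F 0<c
  with r , r<ℓ , 0<∑ ← ∑-positive ℓ _ 0<c
  with k , k<a , 0<F ← ∑-positive (a r) _ 0<∑ = r , k , r<ℓ , k<a , 0<F

∑-cells-comm : ∀ n ℓ a (F : ℕ → ℕ → ℕ → ℕ) →
  ∑ n (λ v → cells ℓ a (F v)) ≡ cells ℓ a (λ r k → ∑ n (λ v → F v r k))
∑-cells-comm n ℓ a F =
  trans (∑-comm n ℓ _) (∑-cong ℓ (λ r _ → ∑-comm n (a r) (λ v → F v r)))

cells-*ˡ : ∀ ℓ a c F → cells ℓ a (λ r k → c * F r k) ≡ c * cells ℓ a F
cells-*ˡ ℓ a c F = trans (∑-cong ℓ (λ r _ → ∑-*ˡ (a r) c (F r))) (∑-*ˡ ℓ c _)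

-- All entries lie in 1, ..., n, so the sum over the boxes of a function of the entry depends on the
-- content alone. This turns facts about contents into facts about entries.
cells-by-value : ∀ {ℓ a n g} → Filling ℓ a n g → (φ : ℕ → ℕ) →
  cells ℓ a (λ r k → φ (g r k)) ≡ ∑ n (λ v → φ (suc v) * occurrences ℓ a g (suc v))
cells-by-value {ℓ} {a} {n} {g} F φ = sym (begin
  ∑ n (λ v → φ (suc v) * occurrences ℓ a g (suc v))
    ≡⟨ ∑-cong n (λ v _ → sym (cells-*ˡ ℓ a (φ (suc v)) _)) ⟩
  ∑ n (λ v → cells ℓ a (λ r k → φ (suc v) * 𝟙 (suc v ≟ g r k)))
    ≡⟨ ∑-cells-comm n ℓ a _ ⟩
  cells ℓ a (λ r k → ∑ n (λ v → φ (suc v) * 𝟙 (suc v ≟ g r k)))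
    ≡⟨ cells-cong ℓ a (λ r k r<ℓ k<a → pick (g r k) (positive r<ℓ k<a) (bounded r<ℓ k<a)) ⟩
  cells ℓ a (λ r k → φ (g r k)) ∎)
  where
  open ≡-Reasoning
  open Filling F
  pick : ∀ u → 0 < u → u ≤ n → ∑ n (λ v → φ (suc v) * 𝟙 (suc v ≟ u)) ≡ φ u
  pick (suc u) _ u<n = trans
    (∑-single n _ u<n (λ j _ j≢u → trans (cong (φ (suc j) *_) (𝟙-no (suc j ≟ suc u) (j≢u ∘ suc-injective)))
                                         (*-zeroʳ (φ (suc j)))))
    (trans (cong (φ (suc u) *_) (𝟙-yes (suc u ≟ suc u) refl)) (*-identityʳ _))

module FillingProperties {ℓ a n g} (F : Filling ℓ a n g) where
  open Filling F

  row-head : ∀ {r} k → r < ℓ → k < a r → g r k ≤ g r 0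
  row-head zero    _   _    = ≤-refl
  row-head (suc k) r<ℓ sk<a = ≤-trans (row-step r<ℓ sk<a) (row-head k r<ℓ (<⇒≤ sk<a))

  col-strict : ∀ {r r′} → r < r′ → r′ < ℓ → g r 0 < g r′ 0
  col-strict {r} {suc r′} (s≤s r≤r′) sr′<ℓ with m≤n⇒m<n∨m≡n r≤r′
  ... | inj₁ r<r′ = <-trans (col-strict r<r′ (<⇒≤ sr′<ℓ)) (col-step sr′<ℓ)
  ... | inj₂ refl = col-step sr′<ℓ

  col-mono : ∀ {r r′} → r ≤ r′ → r′ < ℓ → g r 0 ≤ g r′ 0
  col-mono r≤r′ r′<ℓ with m≤n⇒m<n∨m≡n r≤r′
  ... | inj₁ r<r′ = <⇒≤ (col-strict r<r′ r′<ℓ)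
  ... | inj₂ refl = ≤-refl

  col-lower : ∀ {b} r → (∀ {s} → s < ℓ → b ≤ g s 0) → r < ℓ → b + r ≤ g r 0
  col-lower {b} zero    low 0<ℓ  = subst (_≤ g 0 0) (sym (+-identityʳ b)) (low 0<ℓ)
  col-lower {b} (suc r) low sr<ℓ = subst (_≤ g (suc r) 0) (sym (+-suc b r))
    (≤-<-trans (col-lower r low (<⇒≤ sr<ℓ)) (col-step sr<ℓ))

  col-upper : ∀ {b} r s → (∀ {i} → i < ℓ → g i 0 ≤ b) → suc (r + s) ≡ ℓ → g r 0 + s ≤ b
  col-upper {b} r zero    up eq = subst (_≤ b) (sym (+-identityʳ _))
    (up (subst (r <_) eq (s≤s (m≤m+n r 0))))
  col-upper {b} r (suc s) up eq = begin
    g r 0 + suc s   ≡⟨ +-suc (g r 0) s ⟩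
    suc (g r 0 + s) ≤⟨ +-monoˡ-≤ s (col-step sr<ℓ) ⟩
    g (suc r) 0 + s ≤⟨ col-upper (suc r) s up (trans (cong suc (sym (+-suc r s))) eq) ⟩
    b ∎
    where
    open ≤-Reasoning
    sr<ℓ : suc r < ℓ
    sr<ℓ = subst (suc r <_) eq (s≤s (subst (r <_) (sym (+-suc r s)) (s≤s (m≤m+n r s))))

  -- Induction on the column: the inequality in column k supplies y ≤ z for the type B triple, so
  -- the lower entry is also less than the next entry of the longer row, and the lower row weakly
  -- decreases.
  longer-above : ∀ {i i′} k → i < i′ → i′ < ℓ → a i < a i′ → k < a i → g i k < g i′ k
  longer-above zero    i<i′ i′<ℓ _ _ = col-strict i<i′ i′<ℓ
  longer-above (suc k) i<i′ i′<ℓ ai<ai′ sk<a =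
    ≤-<-trans (row-step (<-trans i<i′ i′<ℓ) sk<a)
      (typeB i<i′ i′<ℓ ai<ai′ (<⇒≤ sk<a) (<-trans sk<a ai<ai′)
        (<⇒≤ (longer-above k i<i′ i′<ℓ ai<ai′ (<⇒≤ sk<a))))

  longer-above-next : ∀ {i i′ k} → i < i′ → i′ < ℓ → a i < a i′ → k < a i → suc k < a i′ →
                      g i k < g i′ (suc k)
  longer-above-next i<i′ i′<ℓ ai<ai′ k<a sk<a′ =
    typeB i<i′ i′<ℓ ai<ai′ k<a sk<a′ (<⇒≤ (longer-above _ i<i′ i′<ℓ ai<ai′ k<a))

  -- If the lower row is shorter, `longer-above` separates the entries. Otherwise equal entries give
  -- x = y ≤ z in a type A triple, which is then not an inversion triple.
  column-distinct-< : ∀ {i i′} k → i < i′ → i′ < ℓ → k < a i → k < a i′ → g i k ≢ g i′ k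
  column-distinct-< zero i<i′ i′<ℓ _ _ = <⇒≢ (col-strict i<i′ i′<ℓ)
  column-distinct-< {i} {i′} (suc k) i<i′ i′<ℓ sk<a sk<a′ eq with a i <? a i′
  ... | yes ai<ai′ = <⇒≢ (longer-above (suc k) i<i′ i′<ℓ ai<ai′ sk<a) eq
  ... | no  ai≮ai′ = <⇒≢ (typeA i<i′ i′<ℓ (≮⇒≥ ai≮ai′) sk<a′
        (subst (_≤ g i k) eq (row-step (<-trans i<i′ i′<ℓ) sk<a))) (sym eq)

  column-distinct : ∀ {i i′ k} → i < ℓ → i′ < ℓ → k < a i → k < a i′ → g i k ≡ g i′ k → i ≡ i′
  column-distinct {i} {i′} {k} i<ℓ i′<ℓ k<a k<a′ eq with <-cmp i i′
  ... | tri< i<i′ _ _ = contradiction eq (column-distinct-< k i<i′ i′<ℓ k<a k<a′)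
  ... | tri≈ _ i≡i′ _ = i≡i′
  ... | tri> _ _ i′<i = contradiction (sym eq) (column-distinct-< k i′<i i<ℓ k<a′ k<a)

  -- A longer higher row is excluded by type B. Otherwise equality would make y = z in a type A
  -- triple, and then y < x ≤ z = y. Both rigidity arguments, for tight contents and for n = ℓ, rest
  -- on this.
  no-descent : ∀ {r s k} → s < r → r < ℓ → suc k < a r → k < a s → g s k ≤ g r k →
               g r (suc k) ≢ g s k
  no-descent {r} {s} {k} s<r r<ℓ sk<a k<as gsk≤grk eq with a s <? a r
  ... | yes as<ar = <⇒≢ (typeB s<r r<ℓ as<ar k<as sk<a gsk≤grk) (sym eq)
  ... | no  as≮ar = <-irrefl eq (<-≤-trans
        (typeA s<r r<ℓ (≮⇒≥ as≮ar) sk<a (≤-reflexive eq))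
        (row-step (<-trans s<r r<ℓ) (<-≤-trans sk<a (≮⇒≥ as≮ar))))

StrictlyIncreasing : (ℕ → ℕ) → Set
StrictlyIncreasing f = ∀ {i j} → i < j → f i < f j

constant-rows : ∀ {ℓ a n f} → StrictlyIncreasing f → (∀ {r} → r < ℓ → 0 < f r) →
                (∀ {r} → r < ℓ → f r ≤ n) → Filling ℓ a n (λ r _ → f r)
constant-rows f-inc f-pos f-bd = record
  { positive = λ r<ℓ _ → f-pos r<ℓ
  ; bounded  = λ r<ℓ _ → f-bd r<ℓ
  ; row-step = λ _ _ → ≤-refl
  ; col-step = λ {r} _ → f-inc (n<1+n r)
  ; typeA    = λ i<i′ _ _ _ fi′≤fi → contradiction (<-≤-trans (f-inc i<i′) fi′≤fi) (<-irrefl refl)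
  ; typeB    = λ i<i′ _ _ _ _ _ → f-inc i<i′
  }

-- The altered row is `suc q` because it must have a row below it. Only its last box changes, which
-- is never the left box z of a triple.
lowered : (ℕ → ℕ) → (ℕ → ℕ) → ℕ → ℕ → ℕ → ℕ → ℕ
lowered f a q v r k = if does (r ≟ suc q) ∧ does (suc k ≟ a (suc q)) then v else f r

data LoweredView (f a : ℕ → ℕ) (q v : ℕ) : ℕ → ℕ → Set where
  regular : ∀ {r k} → (r ≡ suc q → suc k ≢ a (suc q)) → lowered f a q v r k ≡ f r →
            LoweredView f a q v r k
  special : ∀ {k} → suc k ≡ a (suc q) → lowered f a q v (suc q) k ≡ v →
            LoweredView f a q v (suc q) k

loweredView : ∀ f a q v r k → LoweredView f a q v r k
loweredView f a q v r k with r ≟ suc q | suc k ≟ a (suc q)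
... | no r≢sq | _ = regular (λ r≡sq → contradiction r≡sq r≢sq) lemma
  where
  lemma : lowered f a q v r k ≡ f r
  lemma rewrite dec-false (r ≟ suc q) r≢sq = refl
... | yes r≡sq | no  ≢a = regular (λ _ → ≢a) lemma
  where
  lemma : lowered f a q v r k ≡ f r
  lemma rewrite dec-false (suc k ≟ a (suc q)) ≢a | ∧-zeroʳ (does (r ≟ suc q)) = refl
... | yes refl | yes ≡a = special ≡a lemma
  where
  lemma : lowered f a q v (suc q) k ≡ v
  lemma rewrite dec-true (suc q ≟ suc q) refl | dec-true (suc k ≟ a (suc q)) ≡a = refl

lowered-regular : ∀ f a q v r k → suc k < a r → lowered f a q v r k ≡ f r
lowered-regular f a q v r k sk<a with loweredView f a q v r k
... | regular _ eq = eq
... | special eqk _ = contradiction eqk (<⇒≢ sk<a)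

lowered-other : ∀ f a q v r k → r ≢ suc q → lowered f a q v r k ≡ f r
lowered-other f a q v r k r≢sq with loweredView f a q v r k
... | regular _ eq = eq
... | special _ _ = contradiction refl r≢sq

lowered-≤ : ∀ f a q v r k → v ≤ f (suc q) → lowered f a q v r k ≤ f r
lowered-≤ f a q v r k v≤f with loweredView f a q v r k
... | regular _ eq = ≤-reflexive eq
... | special _ eq = subst (_≤ f (suc q)) (sym eq) v≤f

module _ {ℓ : ℕ} {a : ℕ → ℕ} {n : ℕ} {f : ℕ → ℕ} {q v : ℕ} (f-inc : StrictlyIncreasing f) (f-pos : ∀ {r} → r < ℓ → 0 < f r)
         (f-bd : ∀ {r} → r < ℓ → f r ≤ n) (0<v : 0 < v) (v<f : v < f (suc q))
         (f<v : ∀ {r} → r < q → f r < v) (2≤a : 1 < a (suc q))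
         (shape : (suc (a q) < a (suc q)) ⊎ (a (suc q) < a q × v < f q))
  where

  private
    L : ℕ → ℕ → ℕ
    L = lowered f a q v

    L≤f : ∀ r k → L r k ≤ f r
    L≤f r k = lowered-≤ f a q v r k (<⇒≤ v<f)

  -- The new entry v exceeds the rows below q, so only row q can conflict with it. If row q is
  -- shorter by at least 2, it does not reach the column before the altered box and forms no type B
  -- triple with it. If row q is longer, v < f q makes the type A triple an inversion triple.
  lowered-filling : Filling ℓ a n L
  lowered-filling = record
    { positive = λ {r} {k} → pos r k
    ; bounded  = λ {r} {k} r<ℓ _ → ≤-trans (L≤f r k) (f-bd r<ℓ)
    ; row-step = λ {r} {k} r<ℓ sk<a →
        ≤-trans (L≤f r (suc k)) (≤-reflexive (sym (lowered-regular f a q v r k sk<a)))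
    ; col-step = λ {r} _ → subst (L r 0 <_) (sym (head (suc r)))
                             (≤-<-trans (L≤f r 0) (f-inc (n<1+n r)))
    ; typeA = tA
    ; typeB = tB
    }
    where
    pos : ∀ r k → r < ℓ → k < a r → 0 < L r k
    pos r k r<ℓ _ with loweredView f a q v r k
    ... | regular _ eq = subst (0 <_) (sym eq) (f-pos r<ℓ)
    ... | special _ eq = subst (0 <_) (sym eq) 0<v

    head : ∀ r → L r 0 ≡ f r
    head r with loweredView f a q v r 0
    ... | regular _ eq = eq
    ... | special eqk _ = contradiction eqk (<⇒≢ 2≤a)

    tA : ∀ {i i′ k} → i < i′ → i′ < ℓ → a i′ ≤ a i → suc k < a i′ →
         L i′ (suc k) ≤ L i k → L i′ (suc k) < L i (suc k)
    tA {i} {i′} {k} i<i′ i′<ℓ ai′≤ai sk<a′ y≤z with loweredView f a q v i′ (suc k)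
    ... | regular _ eq = contradiction
            (<-≤-trans (f-inc i<i′) (≤-trans (≤-reflexive (sym eq)) (≤-trans y≤z (L≤f i k))))
            (<-irrefl refl)
    ... | special eqk eq with m≤n⇒m<n∨m≡n (s≤s⁻¹ i<i′)
    ...   | inj₁ i<q = contradiction
            (<-≤-trans (f<v i<q) (≤-trans (≤-reflexive (sym eq)) (≤-trans y≤z (L≤f i k))))
            (<-irrefl refl)
    ...   | inj₂ refl = [ (λ short → contradiction (<-≤-trans (<⇒≤ short) ai′≤ai) (<-irrefl refl))
                        , (λ (_ , v<fq) → subst (L (suc q) (suc k) <_)
                             (sym (lowered-other f a q v q (suc k) (1+n≢n ∘ sym)))
                             (subst (_< f q) (sym eq) v<fq)) ]′ shape

    tB : ∀ {i i′ k} → i < i′ → i′ < ℓ → a i < a i′ → k < a i → suc k < a i′ →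
         L i k ≤ L i′ k → L i k < L i′ (suc k)
    tB {i} {i′} {k} i<i′ i′<ℓ ai<ai′ k<a sk<a′ _ with loweredView f a q v i′ (suc k)
    ... | regular _ eq = subst (L i k <_) (sym eq) (≤-<-trans (L≤f i k) (f-inc i<i′))
    ... | special eqk eq with m≤n⇒m<n∨m≡n (s≤s⁻¹ i<i′)
    ...   | inj₁ i<q = subst (L i k <_) (sym eq) (≤-<-trans (L≤f i k) (f<v i<q))
    ...   | inj₂ refl = [ (λ short → contradiction
                               (<-≤-trans k<a (s≤s⁻¹ (s≤s⁻¹ (subst (suc (a q) <_) (sym eqk) short))))
                               (<-irrefl refl))
                        , (λ (long , _) → contradiction (<-trans long ai<ai′) (<-irrefl refl)) ]′ shape

-- Complementing the content

-- Only existence is demanded, which is what nonvanishing coefficients give. With v counted from 0,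
-- the values `suc v` and `n ∸ v` add up to n + 1.
Dual : ℕ → ℕ → (ℕ → ℕ) → ℕ → (ℕ → ℕ) → Set
Dual n ℓ a ℓ′ a′ = ∀ {g} → Filling ℓ a n g → ∃ λ g′ → Filling ℓ′ a′ n g′ ×
  (∀ v → v < n → occurrences ℓ′ a′ g′ (suc v) ≡ occurrences ℓ a g (n ∸ v))

suc-sum-∸ : ∀ {n} i j → suc (i + j) ≡ n → n ∸ i ≡ suc j
suc-sum-∸ i j refl = trans (cong (_∸ i) (sym (+-suc i j))) (m+n∸m≡n i (suc j))

suc-sum-comm : ∀ {n} i j → suc (i + j) ≡ n → suc (j + i) ≡ n
suc-sum-comm i j = trans (cong suc (+-comm j i))

suc-sum-< : ∀ {n} i j → suc (i + j) ≡ n → i < n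
suc-sum-< i j refl = s≤s (m≤m+n i j)

module Transfer {n ℓ a ℓ′ a′ g g′} (F : Filling ℓ a n g) (F′ : Filling ℓ′ a′ n g′)
  (occ : ∀ v → v < n → occurrences ℓ′ a′ g′ (suc v) ≡ occurrences ℓ a g (n ∸ v)) where

  ∑-occurrences : (φ ψ : ℕ → ℕ → ℕ) → (∀ i j m → suc (i + j) ≡ n → φ i m ≡ ψ j m) →
    ∑ n (λ v → φ v (occurrences ℓ′ a′ g′ (suc v))) ≡ ∑ n (λ v → ψ v (occurrences ℓ a g (suc v)))
  ∑-occurrences φ ψ h = ∑-reverse n λ i j eq → trans (h i j _ eq)
    (cong (ψ j) (trans (occ i (suc-sum-< i j eq)) (cong (occurrences ℓ a g) (suc-sum-∸ i j eq))))

  transfer : (φ : ℕ → ℕ) → cells ℓ′ a′ (λ r k → φ (g′ r k)) ≡ cells ℓ a (λ r k → φ (suc n ∸ g r k))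
  transfer φ = begin
    cells ℓ′ a′ (λ r k → φ (g′ r k))
      ≡⟨ cells-by-value F′ φ ⟩
    ∑ n (λ v → φ (suc v) * occurrences ℓ′ a′ g′ (suc v))
      ≡⟨ ∑-occurrences (λ v m → φ (suc v) * m) (λ v m → φ (n ∸ v) * m)
           (λ i j m eq → cong (λ u → φ u * m) (sym (suc-sum-∸ j i (suc-sum-comm i j eq)))) ⟩
    ∑ n (λ v → φ (n ∸ v) * occurrences ℓ a g (suc v))
      ≡⟨ cells-by-value F (λ u → φ (suc n ∸ u)) ⟨
    cells ℓ a (λ r k → φ (suc n ∸ g r k)) ∎
    where open ≡-Reasoning

  -- `transfer` is applied to the indicator of the single value `g′ r k`, whose count in `g′` is
  -- positive.
  source : ∀ {r k} → r < ℓ′ → k < a′ r →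
           ∃ λ s → ∃ λ m → s < ℓ × m < a s × g′ r k + g s m ≡ suc n
  source {r} {k} r<ℓ k<a
    with s , m , s<ℓ , m<a , 0<1 ← cells-positive ℓ a _ (subst (0 <_) (transfer (λ v → 𝟙 (g′ r k ≟ v)))
           (<-≤-trans (≤-reflexive (sym (𝟙-yes (g′ r k ≟ g′ r k) refl)))
                      (term≤cells ℓ′ a′ (λ r₁ k₁ → 𝟙 (g′ r k ≟ g′ r₁ k₁)) r<ℓ k<a)))
    = s , m , s<ℓ , m<a ,
      trans (cong (_+ g s m) (𝟙-positive (g′ r k ≟ suc n ∸ g s m) 0<1))
            (m∸n+n≡m (m≤n⇒m≤1+n (Filling.bounded F s<ℓ m<a)))

identity-rows : ∀ {ℓ n} a → ℓ ≤ n → Filling ℓ a n (λ r _ → suc r)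
identity-rows a ℓ≤n = constant-rows s<s (λ _ → z<s) (λ r<ℓ → ≤-trans r<ℓ ℓ≤n)

occurrences-row : ∀ ℓ a g v {r} → r < ℓ → (∀ {k} → k < a r → v ≡ g r k) →
                  (∀ {s k} → s < ℓ → k < a s → s ≢ r → v ≢ g s k) → occurrences ℓ a g v ≡ a r
occurrences-row ℓ a g v {r} r<ℓ here-v others = begin
  occurrences ℓ a g v              ≡⟨ ∑-single ℓ _ r<ℓ (λ s s<ℓ s≢r → ∑-zero (a s) (λ k k<a →
                                        𝟙-no (v ≟ g s k) (others s<ℓ k<a s≢r))) ⟩
  ∑ (a r) (λ k → 𝟙 (v ≟ g r k))    ≡⟨ ∑-cong (a r) (λ k k<a → 𝟙-yes (v ≟ g r k) (here-v k<a)) ⟩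
  ∑ (a r) (λ _ → 1)                ≡⟨ ∑-const (a r) 1 ⟩
  a r * 1                          ≡⟨ *-identityʳ (a r) ⟩
  a r                              ∎
  where open ≡-Reasoning

occurrences-identity : ∀ ℓ a {r} → r < ℓ → occurrences ℓ a (λ r _ → suc r) (suc r) ≡ a r
occurrences-identity ℓ a {r} r<ℓ =
  occurrences-row ℓ a _ (suc r) r<ℓ (λ _ → refl) (λ _ _ s≢r eq → s≢r (sym (suc-injective eq)))

module DualLength {n ℓ ℓ′ : ℕ} {a′ : ℕ → ℕ} (a : ℕ → ℕ) (ℓ≤n : ℓ ≤ n) (a′-pos : ∀ {r} → r < ℓ′ → 0 < a′ r)
  {g′} (F′ : Filling ℓ′ a′ n g′)
  (occ : ∀ v → v < n → occurrences ℓ′ a′ g′ (suc v) ≡ occurrences ℓ a (λ r _ → suc r) (n ∸ v)) where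

  open Transfer (identity-rows a ℓ≤n) F′ occ
  open FillingProperties F′

  entry-lower : ∀ {r} → r < ℓ′ → suc n ∸ ℓ ≤ g′ r 0
  entry-lower {r} r<ℓ′ with s , m , s<ℓ , _ , eq ← source r<ℓ′ (a′-pos r<ℓ′) =
    m≤n+o⇒m∸n≤o (suc n) ℓ (≤-trans (≤-reflexive (trans (sym eq) (+-comm (g′ r 0) (suc s))))
                                   (+-monoˡ-≤ (g′ r 0) s<ℓ))

  -- The first column is strictly increasing and, by `entry-lower`, lies among the ℓ values n + 1 -
  -- ℓ, ..., n.
  length-≤ : ℓ′ ≤ ℓ
  length-≤ = bound ℓ′ ≤-refl
    where
    bound : ∀ m → m ≤ ℓ′ → m ≤ ℓ
    bound zero    _     = z≤n
    bound (suc m) sm≤ℓ′ = +-cancelˡ-≤ (n ∸ ℓ) (suc m) ℓ (begin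
      n ∸ ℓ + suc m         ≡⟨ +-suc (n ∸ ℓ) m ⟩
      suc (n ∸ ℓ) + m       ≡⟨ cong (_+ m) (+-∸-assoc 1 ℓ≤n) ⟨
      suc n ∸ ℓ + m         ≤⟨ col-lower m entry-lower sm≤ℓ′ ⟩
      g′ m 0                ≤⟨ Filling.bounded F′ sm≤ℓ′ (a′-pos sm≤ℓ′) ⟩
      n                     ≡⟨ m∸n+n≡m ℓ≤n ⟨
      n ∸ ℓ + ℓ             ∎)
      where open ≤-Reasoning

-- The triangular potential

-- C(c, 2) in the form 0 + 1 + ... + (c - 1), the least sum of c distinct column indices.
triangular : ℕ → ℕ
triangular c = ∑ c id

∑<n : ∀ n f {j} → j < n → f j ≡ 0 → (∀ i → i < n → f i ≤ 1) → ∑ n f < n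
∑<n n f j<n fj≡0 h = <-≤-trans (∑-mono-< n _ j<n (s≤s (≤-reflexive fj≡0)) h)
                               (≤-reflexive (trans (∑-const n 1) (*-identityʳ n)))

∑≤1 : ∀ n f → (∀ i → i < n → f i ≤ 1) →
      (∀ i j → i < n → j < n → 0 < f i → 0 < f j → i ≡ j) → ∑ n f ≤ 1
∑≤1 n f f≤1 unique with ∑ n f in eq
... | zero  = z≤n
... | suc m with i , i<n , 0<fi ← ∑-positive n f (subst (0 <_) (sym eq) z<s) =
  subst (_≤ 1) (trans (sym (∑-single n f i<n off)) eq) (f≤1 i i<n)
  where
  off : ∀ j → j < n → j ≢ i → f j ≡ 0
  off j j<n j≢i with f j in eqj
  ... | zero  = refl
  ... | suc _ = contradiction (unique j i j<n i<n (subst (0 <_) (sym eqj) z<s) 0<fi) j≢i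

≤1-cases : ∀ {m} → m ≤ 1 → m ≡ 0 ⊎ m ≡ 1
≤1-cases z≤n       = inj₁ refl
≤1-cases (s≤s z≤n) = inj₂ refl

-- Here p is the indicator of a set of columns. The induction adds the largest index m, which is at
-- least the number of smaller elements.
triangular-≤ : ∀ m p → (∀ k → k < m → p k ≤ 1) → triangular (∑ m p) ≤ ∑ m (λ k → k * p k)
triangular-≤ zero    p p≤1 = z≤n
triangular-≤ (suc m) p p≤1 rewrite ∑-last m p | ∑-last m (λ k → k * p k)
  with IH ← triangular-≤ m p (λ k k<m → p≤1 k (m<n⇒m<1+n k<m)) | ≤1-cases (p≤1 m ≤-refl)
... | inj₁ p≡0 rewrite p≡0 | +-identityʳ (∑ m p) = m≤n⇒m≤n+o _ IH
... | inj₂ p≡1 rewrite p≡1 | +-comm (∑ m p) 1 | ∑-last (∑ m p) id | *-identityʳ m =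
  +-mono-≤ IH (∑≤n m p (λ k k<m → p≤1 k (m<n⇒m<1+n k<m)))

-- A set containing k + 1 but not k is not an initial segment: when k + 1 is added, fewer than k + 1
-- smaller elements are present.
triangular-< : ∀ m p k → (∀ k → k < m → p k ≤ 1) → suc k < m → p k ≡ 0 → p (suc k) ≡ 1 →
               triangular (∑ m p) < ∑ m (λ k → k * p k)
triangular-< (suc m) p k p≤1 sk<sm pk≡0 psk≡1
  rewrite ∑-last m p | ∑-last m (λ k → k * p k)
  with below ← (λ i i<m → p≤1 i (m<n⇒m<1+n i<m)) | m≤n⇒m<n∨m≡n (s≤s⁻¹ sk<sm)
... | inj₂ refl rewrite psk≡1 | +-comm (∑ m p) 1 | ∑-last (∑ m p) id | *-identityʳ m =
  +-mono-≤-< (triangular-≤ m p below) (∑<n m p ≤-refl pk≡0 below)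
... | inj₁ sk<m with IH ← triangular-< m p k below sk<m pk≡0 psk≡1 | ≤1-cases (p≤1 m ≤-refl)
...   | inj₁ p≡0 rewrite p≡0 | +-identityʳ (∑ m p) = m≤n⇒m≤n+o _ IH
...   | inj₂ p≡1 rewrite p≡1 | +-comm (∑ m p) 1 | ∑-last (∑ m p) id | *-identityʳ m =
  +-mono-<-≤ IH (∑≤n m p below)

module Potential {ℓ a n g} (F : Filling ℓ a n g) where
  open Filling F
  open FillingProperties F
  open ≡-Reasoning

  private
    -- A common bound for the row lengths, which lets sums over rows and columns be exchanged.
    width : ℕ
    width = ∑ ℓ a

    a≤width : ∀ {r} → r < ℓ → a r ≤ width
    a≤width = term≤∑ ℓ a

    inColumn : ℕ → ℕ → ℕ → ℕ
    inColumn v k r = 𝟙 (k <? a r) * 𝟙 (v ≟ g r k)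

    column : ℕ → ℕ → ℕ
    column v k = ∑ ℓ (inColumn v k)

    inColumn-positive : ∀ v k r → 0 < inColumn v k r → k < a r × v ≡ g r k
    inColumn-positive v k r = 𝟙*𝟙-positive (k <? a r) (v ≟ g r k)

    inColumn-one : ∀ {k r} → k < a r → inColumn (g r k) k r ≡ 1
    inColumn-one {k} {r} k<a = cong₂ _*_ (𝟙-yes (k <? a r) k<a) (𝟙-yes (g r k ≟ g r k) refl)

    column≤1 : ∀ v k → column v k ≤ 1
    column≤1 v k = ∑≤1 ℓ _ (λ r _ → *-mono-≤ (𝟙≤1 (k <? a r)) (𝟙≤1 (v ≟ g r k)))
      λ r s r<ℓ s<ℓ pr ps → column-distinct r<ℓ s<ℓ (proj₁ (inColumn-positive v k r pr))
        (proj₁ (inColumn-positive v k s ps))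
        (trans (sym (proj₂ (inColumn-positive v k r pr))) (proj₂ (inColumn-positive v k s ps)))

    occurrences-by-column : ∀ v → occurrences ℓ a g v ≡ ∑ width (column v)
    occurrences-by-column v = trans (∑-cong ℓ (λ r r<ℓ → sym (∑-restrict (λ k → 𝟙 (v ≟ g r k)) (a≤width r<ℓ))))
                            (∑-comm ℓ width (λ r k → inColumn v k r))

    column-total : ∀ k → ∑ n (λ v → column (suc v) k) ≡ ∑ ℓ (λ r → 𝟙 (k <? a r))
    column-total k = trans (∑-comm n ℓ (λ v r → inColumn (suc v) k r)) (∑-cong ℓ row-total)
      where
      row-total : ∀ r → r < ℓ → ∑ n (λ v → inColumn (suc v) k r) ≡ 𝟙 (k <? a r)
      row-total r r<ℓ = trans (∑-*ˡ n (𝟙 (k <? a r)) _) (scale (k <? a r))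
        where
        one-value : ∀ u → 0 < u → u ≤ n → ∑ n (λ v → 𝟙 (suc v ≟ u)) ≡ 1
        one-value (suc u) _ u<n = trans
          (∑-single n _ u<n (λ j _ j≢u → 𝟙-no (suc j ≟ suc u) (j≢u ∘ suc-injective)))
          (𝟙-yes (suc u ≟ suc u) refl)
        scale : (k<a? : Dec (k < a r)) → 𝟙 k<a? * ∑ n (λ v → 𝟙 (suc v ≟ g r k)) ≡ 𝟙 k<a?
        scale (no  _)   = refl
        scale (yes k<a) = trans (+-identityʳ _) (one-value (g r k) (positive r<ℓ k<a) (bounded r<ℓ k<a))

    -- Both sides weigh every box by its column index, grouped once by entry and once by row.
    column-weights : ∑ n (λ v → ∑ width (λ k → k * column (suc v) k)) ≡ ∑ ℓ (triangular ∘ a)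
    column-weights = begin
      ∑ n (λ v → ∑ width (λ k → k * column (suc v) k))
        ≡⟨ ∑-comm n width _ ⟩
      ∑ width (λ k → ∑ n (λ v → k * column (suc v) k))
        ≡⟨ ∑-cong width (λ k _ → trans (∑-*ˡ n k _) (cong (k *_) (column-total k))) ⟩
      ∑ width (λ k → k * ∑ ℓ (λ r → 𝟙 (k <? a r)))
        ≡⟨ ∑-cong width (λ k _ → trans (sym (∑-*ˡ ℓ k _)) (∑-cong ℓ (λ r _ → *-comm k _))) ⟩
      ∑ width (λ k → ∑ ℓ (λ r → 𝟙 (k <? a r) * k))
        ≡⟨ ∑-comm width ℓ _ ⟩
      ∑ ℓ (λ r → ∑ width (λ k → 𝟙 (k <? a r) * k))
        ≡⟨ ∑-cong ℓ (λ r r<ℓ → ∑-restrict id (a≤width r<ℓ)) ⟩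
      ∑ ℓ (triangular ∘ a) ∎

    triangular-occurrences : ∀ v →
      triangular (occurrences ℓ a g v) ≤ ∑ width (λ k → k * column v k)
    triangular-occurrences v rewrite occurrences-by-column v =
      triangular-≤ width (column v) (λ k _ → column≤1 v k)

  ∑-triangular-≤ : ∑ n (λ v → triangular (occurrences ℓ a g (suc v))) ≤ ∑ ℓ (triangular ∘ a)
  ∑-triangular-≤ = ≤-trans
    (∑-mono-≤ n (λ v _ → triangular-occurrences (suc v)))
    (≤-reflexive column-weights)

  module Tight (tight : ∑ ℓ (triangular ∘ a) ≤ ∑ n (λ v → triangular (occurrences ℓ a g (suc v)))) where

    -- Tightness forces equality for every single value, so by `triangular-<` the columns containing
    -- a given value form an initial segment.
    nested : ∀ {r k} → r < ℓ → suc k < a r → ∃ λ s → s < ℓ × k < a s × g s k ≡ g r (suc k)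
    nested {r} {k} r<ℓ sk<a with ≤1-cases (column≤1 (g r (suc k)) k)
    ... | inj₂ one with s , s<ℓ , pos ← ∑-positive ℓ _ (subst (0 <_) (sym one) z<s) =
      let k<a , eq = inColumn-positive (g r (suc k)) k s pos in s , s<ℓ , k<a , sym eq
    ... | inj₁ none with g r (suc k) in eq | positive r<ℓ sk<a | bounded r<ℓ sk<a
    ...   | suc u | _ | u<n = contradiction (<-≤-trans strict tight) (<-irrefl refl)
      where
      one : column (suc u) (suc k) ≡ 1
      one = ≤-antisym (column≤1 (suc u) (suc k))
        (≤-trans (≤-reflexive (sym (trans (cong (λ w → inColumn w (suc k) r) (sym eq)) (inColumn-one sk<a))))
                 (term≤∑ ℓ (inColumn (suc u) (suc k)) r<ℓ))
      strict-value : triangular (occurrences ℓ a g (suc u)) < ∑ width (λ k → k * column (suc u) k)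
      strict-value rewrite occurrences-by-column (suc u) =
        triangular-< width (column (suc u)) k (λ k _ → column≤1 (suc u) k)
          (<-≤-trans sk<a (a≤width r<ℓ)) none one
      strict : ∑ n (λ v → triangular (occurrences ℓ a g (suc v))) < ∑ ℓ (triangular ∘ a)
      strict = <-≤-trans (∑-mono-< n u u<n strict-value (λ v _ → triangular-occurrences (suc v)))
                         (≤-reflexive column-weights)

    -- The entry in column k + 1 occurs in column k, in some row s. By induction column k repeats
    -- the first column and so increases upwards: s < r contradicts `no-descent`, and s > r
    -- contradicts the weak decrease of row r.
    rows-constant : ∀ {r} k → r < ℓ → k < a r → g r k ≡ g r 0
    rows-constant zero    _   _    = refl
    rows-constant {r} (suc k) r<ℓ sk<a with nested r<ℓ sk<a
    ... | s , s<ℓ , k<as , eq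
      with IHr ← rows-constant k r<ℓ (<⇒≤ sk<a) | IHs ← rows-constant k s<ℓ k<as | <-cmp s r
    ...   | tri≈ _ refl _ = trans (sym eq) IHr
    ...   | tri< s<r _ _ = contradiction (sym eq) (no-descent s<r r<ℓ sk<a k<as
              (subst₂ _≤_ (sym IHs) (sym IHr) (<⇒≤ (col-strict s<r r<ℓ))))
    ...   | tri> _ _ r<s = contradiction (≤-trans (≤-reflexive eq) (row-step r<ℓ sk<a))
              (<⇒≱ (subst₂ _<_ (sym IHr) (sym IHs) (col-strict r<s s<ℓ)))

module _ {n ℓ : ℕ} {a : ℕ → ℕ} {ℓ′ : ℕ} {a′ : ℕ → ℕ} (ℓ≤n : ℓ ≤ n) (ℓ′≤n : ℓ′ ≤ n)
  (a-pos : ∀ {r} → r < ℓ → 0 < a r) (a′-pos : ∀ {r} → r < ℓ′ → 0 < a′ r)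
  where

  dual-length : Dual n ℓ a ℓ′ a′ → ℓ′ ≤ ℓ
  dual-length D with _ , F′ , occ ← D (identity-rows a ℓ≤n) = DualLength.length-≤ a ℓ≤n a′-pos F′ occ

  triangular-dual : ∀ {g′} (F′ : Filling ℓ′ a′ n g′) →
    (∀ v → v < n → occurrences ℓ′ a′ g′ (suc v) ≡ occurrences ℓ a (λ r _ → suc r) (n ∸ v)) →
    ∑ ℓ (triangular ∘ a) ≤ ∑ n (λ v → triangular (occurrences ℓ′ a′ g′ (suc v)))
  triangular-dual {g′} F′ occ = begin
    ∑ ℓ (triangular ∘ a)
      ≡⟨ ∑-cong ℓ (λ r r<ℓ → cong triangular (sym (occurrences-identity ℓ a r<ℓ))) ⟩
    ∑ ℓ (λ r → triangular (occurrences ℓ a (λ r _ → suc r) (suc r)))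
      ≤⟨ ∑-mono-bound _ ℓ≤n ⟩
    ∑ n (λ r → triangular (occurrences ℓ a (λ r _ → suc r) (suc r)))
      ≡⟨ Transfer.∑-occurrences (identity-rows a ℓ≤n) F′ occ
           (λ _ → triangular) (λ _ → triangular) (λ _ _ _ _ → refl) ⟨
    ∑ n (λ v → triangular (occurrences ℓ′ a′ g′ (suc v))) ∎
    where open ≤-Reasoning

dual⇒reverse : ∀ {n ℓ a ℓ′ a′} → ℓ ≤ n → ℓ′ ≤ n →
  (∀ {r} → r < ℓ → 0 < a r) → (∀ {r} → r < ℓ′ → 0 < a′ r) →
  Dual n ℓ a ℓ′ a′ → Dual n ℓ′ a′ ℓ a →
  ℓ ≡ ℓ′ × (∀ r s → suc (r + s) ≡ ℓ → a r ≡ a′ s)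
dual⇒reverse {n} {ℓ} {a} {ℓ′} {a′} ℓ≤n ℓ′≤n a-pos a′-pos D D′
  with refl ← ≤-antisym (dual-length ℓ′≤n ℓ≤n a′-pos a-pos D′) (dual-length ℓ≤n ℓ′≤n a-pos a′-pos D)
  with g′ , G′ , occ′ ← D (identity-rows a ℓ≤n)
  with g , G , occ ← D′ (identity-rows a′ ℓ≤n) = refl , parts
  where
  open FillingProperties G
  -- The sums for a, `G′`, a′ and `G` form a weakly increasing chain, while `∑-triangular-≤` bounds
  -- the last by the first. Hence the bound is attained at `G`.
  open Potential.Tight G
    (≤-trans (triangular-dual ℓ≤n ℓ≤n a-pos a′-pos G′ occ′)
      (≤-trans (Potential.∑-triangular-≤ G′) (triangular-dual ℓ≤n ℓ≤n a′-pos a-pos G occ)))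

  -- A strictly increasing column of ℓ heads within the ℓ values n + 1 - ℓ, ..., n leaves no choice.
  head-value : ∀ r s → suc (r + s) ≡ ℓ → g r 0 ≡ suc (n ∸ suc s)
  head-value r s eq = trans (≤-antisym upper lower) (+-∸-assoc 1 {n} {suc s} s<n)
    where
    r<ℓ : r < ℓ
    r<ℓ = suc-sum-< r s eq
    s<n : s < n
    s<n = ≤-trans (suc-sum-< s r (suc-sum-comm r s eq)) ℓ≤n
    upper : g r 0 ≤ n ∸ s
    upper = m+n≤o⇒m≤o∸n (g r 0) (col-upper r s (λ i<ℓ → Filling.bounded G i<ℓ (a-pos i<ℓ)) eq)
    lower : n ∸ s ≤ g r 0
    lower = ≤-trans (≤-reflexive lemma)
      (col-lower r (DualLength.entry-lower a′ ℓ≤n a-pos G occ) r<ℓ)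
      where
      lemma : n ∸ s ≡ suc n ∸ ℓ + r
      lemma = sym (begin
        suc n ∸ ℓ + r             ≡⟨ cong (λ m → suc n ∸ m + r) eq ⟨
        n ∸ (r + s) + r           ≡⟨ cong (λ m → n ∸ m + r) (+-comm r s) ⟩
        n ∸ (s + r) + r           ≡⟨ cong (_+ r) (∸-+-assoc n s r) ⟨
        n ∸ s ∸ r + r             ≡⟨ m∸n+n≡m (m+n≤o⇒m≤o∸n r (≤-trans (≤-trans (n≤1+n _) (≤-reflexive eq)) ℓ≤n)) ⟩
        n ∸ s                     ∎)
        where open ≡-Reasoning

  -- Row r of `G` is constant with value n - s, so its length is the multiplicity of that value; the
  -- complement s + 1 fills row s in the chosen filling of a′.
  parts : ∀ r s → suc (r + s) ≡ ℓ → a r ≡ a′ s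
  parts r s eq = begin
    a r
      ≡⟨ occurrences-row ℓ a g _ r<ℓ (λ {k} k<a → sym (trans (rows-constant k r<ℓ k<a) head))
           (λ {i} {k} i<ℓ k<a i≢r eqv → i≢r (column-distinct i<ℓ r<ℓ (a-pos i<ℓ) (a-pos r<ℓ)
              (trans (sym (rows-constant k i<ℓ k<a)) (trans (sym eqv) (sym head))))) ⟨
    occurrences ℓ a g (suc (n ∸ suc s))
      ≡⟨ occ _ (<-≤-trans (m∸n<o n s<n) ≤-refl) ⟩
    occurrences ℓ a′ (λ r _ → suc r) (n ∸ (n ∸ suc s))
      ≡⟨ cong (occurrences ℓ a′ (λ r _ → suc r)) (m∸[m∸n]≡n s<n) ⟩
    occurrences ℓ a′ (λ r _ → suc r) (suc s)
      ≡⟨ occurrences-identity ℓ a′ s<ℓ ⟩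
    a′ s ∎
    where
    open ≡-Reasoning
    r<ℓ : r < ℓ
    r<ℓ = suc-sum-< r s eq
    s<ℓ : s < ℓ
    s<ℓ = suc-sum-< s r (suc-sum-comm r s eq)
    s<n : suc s ≤ n
    s<n = ≤-trans s<ℓ ℓ≤n
    head : g r 0 ≡ suc (n ∸ suc s)
    head = head-value r s eq
    m∸n<o : ∀ n {s} → suc s ≤ n → n ∸ suc s < n
    m∸n<o (suc n) {s} _ = s≤s (m∸n≤m n s)

-- Shapes that are not dual to their reverses

∑-indicator-≤ : ∀ m {P : ℕ → Set} (P? : ∀ k → Dec (P k)) → ∑ m (λ k → 𝟙 (P? k)) ≤ m
∑-indicator-≤ m P? = ∑≤n m _ (λ k _ → 𝟙≤1 (P? k))

∑-indicator-≡ : ∀ m {P : ℕ → Set} (P? : ∀ k → Dec (P k)) → (∀ k → k < m → P k) → ∑ m (λ k → 𝟙 (P? k)) ≡ m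
∑-indicator-≡ m P? h = trans (∑-cong m (λ k k<m → 𝟙-yes (P? k) (h k k<m))) (trans (∑-const m 1) (*-identityʳ m))

module _ {n ℓ a a′ g g′ i j} (F : Filling ℓ a n g) (F′ : Filling ℓ a′ n g′)
  (occ : ∀ v → v < n → occurrences ℓ a′ g′ (suc v) ≡ occurrences ℓ a g (n ∸ v))
  (reversed : ∀ r s → suc (r + s) ≡ ℓ → a′ r ≡ a s)
  (index : suc (j + suc i) ≡ ℓ) where

  open Transfer F F′ occ
  open FillingProperties F′

  -- Otherwise the bottom j + 1 rows of g′ consist of entries ≤ t only, so at least
  -- as many entries as there are cells of g above row i have complement ≤ t.
  large-head : ∀ {t m} → (∀ {r k} → r ≤ i → r < ℓ → k < a r → t < suc n ∸ g r k) →
               m < a (suc i) → t < suc n ∸ g (suc i) m → t < g′ j 0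
  large-head {t} {m} low m<a high with g′ j 0 ≤? t
  ... | no  g′≰t = ≰⇒> g′≰t
  ... | yes g′≤t = contradiction (<-≤-trans above below) (<-irrefl refl)
    where
    j<ℓ : j < ℓ
    j<ℓ = suc-sum-< j (suc i) index
    si<ℓ : suc i < ℓ
    si<ℓ = suc-sum-< (suc i) j (suc-sum-comm j (suc i) index)
    small-row : ∀ r → r < ℓ → 𝟙 (r ≤? j) * a′ r ≤ ∑ (a′ r) (λ k → 𝟙 (g′ r k ≤? t))
    small-row r r<ℓ = 𝟙*-≤ (r ≤? j) (λ r≤j → ≤-reflexive (sym (∑-indicator-≡ (a′ r) (λ k → g′ r k ≤? t)
      (λ k k<a → ≤-trans (row-head k r<ℓ k<a) (≤-trans (col-mono r≤j j<ℓ) g′≤t)))))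
    upper-row : ∀ r → r < ℓ → ∑ (a r) (λ k → 𝟙 (suc n ∸ g r k ≤? t)) ≤ 𝟙 (suc i ≤? r) * a r
    upper-row r r<ℓ = ≤-𝟙* (suc i ≤? r) (∑-indicator-≤ (a r) (λ k → suc n ∸ g r k ≤? t))
      (λ si≰r → ∑-zero (a r) (λ k k<a → 𝟙-no (suc n ∸ g r k ≤? t) (<⇒≱ (low (≮⇒≥ si≰r) r<ℓ k<a))))
    special-row : ∑ (a (suc i)) (λ k → 𝟙 (suc n ∸ g (suc i) k ≤? t)) < 𝟙 (suc i ≤? suc i) * a (suc i)
    special-row = <-≤-trans
      (∑<n (a (suc i)) _ m<a (𝟙-no (suc n ∸ g (suc i) m ≤? t) (<⇒≱ high)) (λ k _ → 𝟙≤1 (suc n ∸ g (suc i) k ≤? t)))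
      (≤-reflexive (sym (trans (cong (_* a (suc i)) (𝟙-yes (suc i ≤? suc i) ≤-refl)) (*-identityˡ (a (suc i))))))
    above : cells ℓ a (λ r k → 𝟙 (suc n ∸ g r k ≤? t)) < ∑ ℓ (λ r → 𝟙 (suc i ≤? r) * a r)
    above = ∑-mono-< ℓ (suc i) si<ℓ special-row upper-row
    below : ∑ ℓ (λ r → 𝟙 (suc i ≤? r) * a r) ≤ cells ℓ a (λ r k → 𝟙 (suc n ∸ g r k ≤? t))
    below = begin
      ∑ ℓ (λ r → 𝟙 (suc i ≤? r) * a r)
        ≡⟨ ∑-reverse ℓ (λ r s eq → cong₂ _*_ (𝟙-cong (r ≤? j) (suc i ≤? s)
             (λ r≤j → +-cancelˡ-≤ j (suc i) s (≤-trans (≤-reflexive (suc-injective (trans index (sym eq))))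
                        (+-monoˡ-≤ s r≤j)))
             (λ i<s → +-cancelʳ-≤ s r j (≤-trans (≤-reflexive (suc-injective (trans eq (sym index))))
                        (+-monoʳ-≤ j i<s))))
             (reversed r s eq)) ⟨
      ∑ ℓ (λ r → 𝟙 (r ≤? j) * a′ r)               ≤⟨ ∑-mono-≤ ℓ small-row ⟩
      cells ℓ a′ (λ r k → 𝟙 (g′ r k ≤? t))         ≡⟨ transfer (λ v → 𝟙 (v ≤? t)) ⟩
      cells ℓ a (λ r k → 𝟙 (suc n ∸ g r k ≤? t))   ∎
      where open ≤-Reasoning

predecessor : ∀ {m} → 0 < m → ∃ λ p → suc p ≡ m
predecessor {suc p} _ = p , refl

reversed-positive : ∀ {ℓ} {a a′ : ℕ → ℕ} → (∀ r s → suc (r + s) ≡ ℓ → a′ r ≡ a s) →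
                    (∀ {r} → r < ℓ → 0 < a r) → ∀ {r} → r < ℓ → 0 < a′ r
reversed-positive {ℓ} reversed a-pos {r} r<ℓ = subst (0 <_) (sym (reversed r (ℓ ∸ suc r) eq))
  (a-pos (suc-sum-< (ℓ ∸ suc r) r (suc-sum-comm r _ eq)))
  where
  eq : suc (r + (ℓ ∸ suc r)) ≡ ℓ
  eq = m+[n∸m]≡n r<ℓ

module _ {n ℓ : ℕ} {a a′ : ℕ → ℕ} {i j : ℕ} (a-pos : ∀ {r} → r < ℓ → 0 < a r)
  (reversed : ∀ r s → suc (r + s) ≡ ℓ → a′ r ≡ a s) (index : suc (j + suc i) ≡ ℓ)
  (D : Dual n ℓ a ℓ a′) where
  private
    si<ℓ : suc i < ℓ
    si<ℓ = suc-sum-< (suc i) j (suc-sum-comm j (suc i) index)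

  -- The witness has row i + 1 filled with i + 2, except for a last entry i + 1.
  no-large-ascent : ℓ ≤ n → ¬ (suc (a i) < a (suc i))
  no-large-ascent ℓ≤n ascent
    with G ← lowered-filling {ℓ} {a} {n} {suc} {i} {suc i} s<s (λ _ → z<s) (λ r<ℓ → ≤-trans r<ℓ ℓ≤n)
               z<s ≤-refl s<s (<-≤-trans (s<s (a-pos (<⇒≤ si<ℓ))) (<⇒≤ ascent)) (inj₁ ascent)
    with g′ , G′ , occ ← D G
    with m , sm≡a ← predecessor (a-pos si<ℓ)
    -- The bound t = n - (i + 1) is the complement of i + 2. Entries up to i + 1, hence the rows
    -- below i + 1 and the lowered box, have larger complements, so `large-head` gives t < `g′ j 0`.
    -- But i + 1 rows lie above row j, so its head is at most t.
    = contradiction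
        (large-head G G′ occ reversed index {n ∸ suc i} {m} low (≤-reflexive sm≡a) high)
        (≤⇒≯ (m+n≤o⇒m≤o∸n (g′ j 0) (FillingProperties.col-upper G′ j (suc i)
          (λ r<ℓ → Filling.bounded G′ r<ℓ (a′-pos r<ℓ)) index)))
    where
    i<n : i < n
    i<n = ≤-trans (<⇒≤ si<ℓ) ℓ≤n
    L : ℕ → ℕ → ℕ
    L = lowered suc a i (suc i)
    t<n∸i : n ∸ suc i < n ∸ i
    t<n∸i = ∸-monoʳ-< (n<1+n i) i<n
    low : ∀ {r k} → r ≤ i → r < ℓ → k < a r → n ∸ suc i < suc n ∸ L r k
    low {r} {k} r≤i r<ℓ _ = <-≤-trans t<n∸i
      (∸-monoʳ-≤ (suc n) (≤-trans (lowered-≤ suc a i (suc i) r k (n≤1+n _)) (s≤s r≤i)))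
    high : n ∸ suc i < suc n ∸ L (suc i) m
    high with loweredView suc a i (suc i) (suc i) m
    ... | regular ≢a _ = contradiction sm≡a (≢a refl)
    ... | special _ eq rewrite eq = t<n∸i
    a′-pos : ∀ {r} → r < ℓ → 0 < a′ r
    a′-pos = reversed-positive reversed a-pos

-- The increasing enumeration of the positive integers other than i + 1.
skip : ℕ → ℕ → ℕ
skip zero    r       = suc (suc r)
skip (suc i) zero    = 1
skip (suc i) (suc r) = suc (skip i r)

skip-< : ∀ {i r} → r < i → skip i r ≡ suc r
skip-< {suc i} {zero}  _     = refl
skip-< {suc i} {suc r} sr<si = cong suc (skip-< (s≤s⁻¹ sr<si))

skip-≥ : ∀ {i r} → i ≤ r → skip i r ≡ suc (suc r)
skip-≥ {zero}          _     = refl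
skip-≥ {suc i} {suc r} si≤sr = cong suc (skip-≥ (s≤s⁻¹ si≤sr))

skip-positive : ∀ i r → 0 < skip i r
skip-positive zero    r       = z<s
skip-positive (suc i) zero    = z<s
skip-positive (suc i) (suc r) = z<s

skip-≤ : ∀ i r → skip i r ≤ suc (suc r)
skip-≤ zero    r       = ≤-refl
skip-≤ (suc i) zero    = s≤s z≤n
skip-≤ (suc i) (suc r) = s≤s (skip-≤ i r)

skip-increasing : ∀ i → StrictlyIncreasing (skip i)
skip-increasing zero            i<j               = s<s (s<s i<j)
skip-increasing (suc i) {zero}  {suc s} _         = s<s (skip-positive i s)
skip-increasing (suc i) {suc r} {suc s} (s≤s r<s) = s<s (skip-increasing i r<s)

skip-≢ : ∀ i r → skip i r ≢ suc i
skip-≢ (suc i) (suc r) eq = skip-≢ i r (suc-injective eq)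

cells-single : ∀ ℓ a F {r k} → r < ℓ → k < a r →
  (∀ {s m} → s < ℓ → m < a s → (s ≡ r → m ≢ k) → F s m ≡ 0) → cells ℓ a F ≡ F r k
cells-single ℓ a F {r} {k} r<ℓ k<a h =
  trans (∑-single ℓ _ r<ℓ (λ s s<ℓ s≢r → ∑-zero (a s) (λ m m<a → h s<ℓ m<a (λ s≡r → contradiction s≡r s≢r))))
        (∑-single (a r) (F r) k<a (λ m m<a m≢k → h r<ℓ m<a (λ _ → m≢k)))

module _ {n ℓ : ℕ} {a a′ : ℕ → ℕ} {i j : ℕ} (a-pos : ∀ {r} → r < ℓ → 0 < a r)
  (reversed : ∀ r s → suc (r + s) ≡ ℓ → a′ r ≡ a s) (index : suc (j + suc i) ≡ ℓ)
  (D : Dual n ℓ a ℓ a′) where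

  -- The witness avoids the value i + 1 in its first column; its row i + 1 is filled with i + 3,
  -- except for a last entry i + 1.
  no-descent-above-one : ℓ < n → a (suc i) < a i → ¬ (1 < a (suc i))
  no-descent-above-one ℓ<n descent 1<a
    with G ← lowered-filling {ℓ} {a} {n} {skip i} {i} {suc i} (skip-increasing i) (λ _ → skip-positive i _)
               (λ {r} r<ℓ → ≤-trans (skip-≤ i r) (≤-trans (s≤s r<ℓ) ℓ<n)) z<s
               (subst (suc i <_) (sym (skip-≥ (n≤1+n i))) (s≤s (n≤1+n _)))
               (λ r<i → subst (_< suc i) (sym (skip-< r<i)) (s<s r<i)) 1<a
               (inj₂ (descent , subst (suc i <_) (sym (skip-≥ ≤-refl)) ≤-refl))
    with g′ , G′ , occ ← D G
    with m , sm≡a ← predecessor (<⇒≤ 1<a)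
    -- The value `w` is the complement of i + 1, which the witness contains exactly once. In `g′`,
    -- the head of row j exceeds `t`, so the first two entries of the longer row j + 1 are at least
    -- `w`, the second by type B; the i rows above bound its head by `w`. Thus `w` occurs twice.
    = contradiction (≤-trans two-cells (≤-trans (≤-reflexive (transfer (λ v → 𝟙 (w ≟ v)))) one-cell)) (<-irrefl refl)
    where
    open Filling G′ using (bounded; row-step; col-step)
    open FillingProperties G′
    open Transfer G G′ occ using (transfer)
    L : ℕ → ℕ → ℕ
    L = lowered (skip i) a i (suc i)
    w t : ℕ
    w = n ∸ i
    t = n ∸ suc (suc i)
    si<ℓ : suc i < ℓ
    si<ℓ = suc-sum-< (suc i) j (suc-sum-comm j (suc i) index)
    si<n : suc i < n
    si<n = <-trans si<ℓ ℓ<n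
    i<n : i < n
    i<n = <⇒≤ si<n
    sj<ℓ : suc j < ℓ
    sj<ℓ = suc-sum-< (suc j) i (trans (cong suc (sym (+-suc j i))) index)
    t<n∸si : t < n ∸ suc i
    t<n∸si = ∸-monoʳ-< (n<1+n (suc i)) si<n
    a′-pos : ∀ {r} → r < ℓ → 0 < a′ r
    a′-pos = reversed-positive reversed a-pos
    head≤n : ∀ {r} → r < ℓ → g′ r 0 ≤ n
    head≤n r<ℓ = bounded r<ℓ (a′-pos r<ℓ)
    L-special : L (suc i) m ≡ suc i
    L-special with loweredView (skip i) a i (suc i) (suc i) m
    ... | regular ≢a _ = contradiction sm≡a (≢a refl)
    ... | special _ eq = eq
    t<g′ : t < g′ j 0
    t<g′ = large-head G G′ occ reversed index {t} {m} low (≤-reflexive sm≡a)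
      (subst (λ u → t < suc n ∸ u) (sym L-special) (<-trans t<n∸si (∸-monoʳ-< (n<1+n i) i<n)))
      where
      low : ∀ {r k} → r ≤ i → r < ℓ → k < a r → t < suc n ∸ L r k
      low {r} {k} r≤i r<ℓ _ = <-≤-trans t<n∸si (∸-monoʳ-≤ (suc n)
        (≤-trans (≤-reflexive (lowered-other (skip i) a i (suc i) r k (<⇒≢ (s≤s r≤i))))
                 (≤-trans (skip-≤ i r) (s≤s (s≤s r≤i)))))
    w≤next : ∀ {u} → g′ j 0 < u → w ≤ u
    w≤next {u} g′<u = ≤-trans (≤-reflexive (trans (suc∸ i<n) (cong suc (suc∸ si<n)))) (≤-trans (s≤s t<g′) g′<u)
      where
      suc∸ : ∀ {x} → x < n → n ∸ x ≡ suc (n ∸ suc x)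
      suc∸ x<n = +-∸-assoc 1 x<n
    head≤w : g′ (suc j) 0 ≤ w
    head≤w = m+n≤o⇒m≤o∸n (g′ (suc j) 0) (col-upper (suc j) i head≤n (trans (cong suc (sym (+-suc j i))) index))
    a′j<a′sj : a′ j < a′ (suc j)
    a′j<a′sj = subst₂ _<_ (sym (reversed j (suc i) index))
      (sym (reversed (suc j) i (trans (cong suc (sym (+-suc j i))) index))) descent
    1<a′sj : 1 < a′ (suc j)
    1<a′sj = ≤-<-trans (a′-pos (<⇒≤ sj<ℓ)) a′j<a′sj
    head≡w : w ≡ g′ (suc j) 0
    head≡w = ≤-antisym (w≤next (col-step sj<ℓ)) head≤w
    next≡w : w ≡ g′ (suc j) 1
    next≡w = ≤-antisym
      (w≤next (longer-above-next ≤-refl sj<ℓ a′j<a′sj (a′-pos (<⇒≤ sj<ℓ)) 1<a′sj))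
      (≤-trans (row-step sj<ℓ 1<a′sj) head≤w)
    two-cells : 2 ≤ cells ℓ a′ (λ r k → 𝟙 (w ≟ g′ r k))
    two-cells = ≤-trans (≤-reflexive (sym (cong₂ _+_ (𝟙-yes (w ≟ g′ (suc j) 0) head≡w)
                                                     (trans (+-identityʳ _) (𝟙-yes (w ≟ g′ (suc j) 1) next≡w)))))
      (≤-trans (∑-mono-bound {2} (λ k → 𝟙 (w ≟ g′ (suc j) k)) 1<a′sj)
               (term≤∑ ℓ (λ r → ∑ (a′ r) (λ k → 𝟙 (w ≟ g′ r k))) sj<ℓ))
    one-cell : cells ℓ a (λ r k → 𝟙 (w ≟ suc n ∸ L r k)) ≤ 1
    one-cell = ≤-trans
      (≤-reflexive (cells-single ℓ a (λ r k → 𝟙 (w ≟ suc n ∸ L r k)) si<ℓ (≤-reflexive sm≡a)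
        (λ {s} {k} s<ℓ k<a other → 𝟙-no (w ≟ suc n ∸ L s k) (λ eq →
          unique s k other (∸-cancelˡ-≡ (≤-trans (Filling.bounded G s<ℓ k<a) (n≤1+n n)) (s≤s (<⇒≤ i<n)) (sym eq))))))
      (𝟙≤1 (w ≟ suc n ∸ L (suc i) m))
      where
      unique : ∀ s k → (s ≡ suc i → k ≢ m) → L s k ≢ suc i
      unique s k other eq with loweredView (skip i) a i (suc i) s k
      ... | regular _ eq′ = skip-≢ i s (trans (sym eq′) eq)
      ... | special sk≡a _ = other refl (suc-injective (trans sk≡a (sym sm≡a)))

-- Coefficients count fillings

at-++ˡ : ∀ xs ys {i} → i < length xs → at (xs ++ ys) i ≡ at xs i
at-++ˡ (x ∷ xs) ys {zero}  _   = refl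
at-++ˡ (x ∷ xs) ys {suc i} i<l = at-++ˡ xs ys (s≤s⁻¹ i<l)

at-++-last : ∀ xs x → at (xs ++ [ x ]) (length xs) ≡ x
at-++-last []       x = refl
at-++-last (_ ∷ xs) x = at-++-last xs x

at-reverse : ∀ xs r s → suc (r + s) ≡ length xs → at (reverse xs) r ≡ at xs s
at-reverse (x ∷ xs) r s eq rewrite unfold-reverse x xs with s
... | zero rewrite trans (sym (+-identityʳ r)) (trans (suc-injective eq) (sym (length-reverse xs))) =
  at-++-last (reverse xs) x
... | suc s =
  trans (at-++ˡ (reverse xs) [ x ] (subst (r <_) (sym (length-reverse xs)) (suc-sum-< r s eq′)))
        (at-reverse xs r s eq′)
  where
  eq′ : suc (r + s) ≡ length xs
  eq′ = trans (sym (+-suc r s)) (suc-injective eq)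

at-applyUpTo : ∀ n f {i} → i < n → at (applyUpTo f n) i ≡ f i
at-applyUpTo (suc n) f {zero}  _   = refl
at-applyUpTo (suc n) f {suc i} i<n = at-applyUpTo n (f ∘ suc) (s≤s⁻¹ i<n)

applyUpTo-cong : ∀ {A : Set} n {f g : ℕ → A} → (∀ i → i < n → f i ≡ g i) → applyUpTo f n ≡ applyUpTo g n
applyUpTo-cong zero    h = refl
applyUpTo-cong (suc n) h = cong₂ _∷_ (h 0 z<s) (applyUpTo-cong n (λ i i<n → h (suc i) (s<s i<n)))

applyUpTo-at : ∀ xs → applyUpTo (at xs) (length xs) ≡ xs
applyUpTo-at []       = refl
applyUpTo-at (x ∷ xs) = cong (x ∷_) (applyUpTo-at xs)

at-∈ : ∀ xs {i} → i < length xs → at xs i ∈ xs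
at-∈ (x ∷ xs) {zero}  _   = here refl
at-∈ (x ∷ xs) {suc i} i<l = there (at-∈ xs (s≤s⁻¹ i<l))

at-All : ∀ {P : ℕ → Set} {xs} → All P xs → ∀ {i} → i < length xs → P (at xs i)
at-All {xs = xs} ps i<l = All.lookup ps (at-∈ xs i<l)

vec : ∀ n → (ℕ → ℕ) → Vec ℕ n
vec zero    f = Vec.[]
vec (suc n) f = f 0 Vec.∷ vec n (f ∘ suc)

at-vec : ∀ n f {i} → i < n → at (toList (vec n f)) i ≡ f i
at-vec (suc n) f {zero}  _   = refl
at-vec (suc n) f {suc i} i<n = at-vec n (f ∘ suc) (s≤s⁻¹ i<n)

at-Vec-reverse : ∀ {n} (e : Vec ℕ n) r s → suc (r + s) ≡ n → at (toList (Vec.reverse e)) r ≡ at (toList e) s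
at-Vec-reverse e r s eq rewrite VecP.toList-reverse e =
  at-reverse (toList e) r s (trans eq (sym (VecP.length-toList e)))

∧-true⁻ : ∀ {x y} → x ∧ y ≡ true → x ≡ true × y ≡ true
∧-true⁻ {true} {true} refl = refl , refl

∧-true⁺ : ∀ {x y} → x ≡ true → y ≡ true → x ∧ y ≡ true
∧-true⁺ refl refl = refl

if-true⁻ : ∀ c {x} → (if c then x else true) ≡ true → c ≡ true → x ≡ true
if-true⁻ _ x≡true refl = x≡true

if-true⁺ : ∀ {c x} → (c ≡ true → x ≡ true) → (if c then x else true) ≡ true
if-true⁺ {true}  h = h refl
if-true⁺ {false} h = refl

T⇒≡true : ∀ {b} → T b → b ≡ true
T⇒≡true = Equivalence.to T-≡

≡true⇒T : ∀ {b} → b ≡ true → T b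
≡true⇒T = Equivalence.from T-≡

<⇒<ᵇ≡true : ∀ {m n} → m < n → (m <ᵇ n) ≡ true
<⇒<ᵇ≡true = T⇒≡true ∘ <⇒<ᵇ

<ᵇ≡true⇒< : ∀ {m n} → (m <ᵇ n) ≡ true → m < n
<ᵇ≡true⇒< = <ᵇ⇒< _ _ ∘ ≡true⇒T

≤⇒≤ᵇ≡true : ∀ {m n} → m ≤ n → (m ≤ᵇ n) ≡ true
≤⇒≤ᵇ≡true = T⇒≡true ∘ ≤⇒≤ᵇ

≤ᵇ≡true⇒≤ : ∀ {m n} → (m ≤ᵇ n) ≡ true → m ≤ n
≤ᵇ≡true⇒≤ = ≤ᵇ⇒≤ _ _ ∘ ≡true⇒T

inversion⁻ : ∀ z y x → inversionᵇ z y x ≡ true → y ≤ z → y < x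
inversion⁻ z y x inv y≤z with y <? x
... | yes y<x = y<x
... | no  y≮x with () ← trans (sym inv) (cong not (∧-true⁺ (≤⇒≤ᵇ≡true y≤z) (≤⇒≤ᵇ≡true (≮⇒≥ y≮x))))

inversion⁺ : ∀ z y x → (y ≤ z → y < x) → inversionᵇ z y x ≡ true
inversion⁺ z y x h with y ≤ᵇ z in eq | x ≤ᵇ y in eq′
... | false | _     = refl
... | true  | false = refl
... | true  | true  = contradiction (h (≤ᵇ≡true⇒≤ eq)) (≤⇒≯ (≤ᵇ≡true⇒≤ eq′))

allBelow⁻ : ∀ m f → allBelow m f ≡ true → ∀ {i} → i < m → f i ≡ true
allBelow⁻ (suc m) f all {i} i<sm with ∧-true⁻ {allBelow m f} all | m≤n⇒m<n∨m≡n (s≤s⁻¹ i<sm)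
... | below , _    | inj₁ i<m  = allBelow⁻ m f below i<m
... | _     , last | inj₂ refl = last

allBelow⁺ : ∀ m f → (∀ i → i < m → f i ≡ true) → allBelow m f ≡ true
allBelow⁺ zero    f h = refl
allBelow⁺ (suc m) f h = ∧-true⁺ (allBelow⁺ m f (λ i i<m → h i (m<n⇒m<1+n i<m))) (h m ≤-refl)

InRange : ℕ → List ℕ → (ℕ → ℕ → ℕ) → Set
InRange n α g = ∀ {r k} → r < length α → k < at α r → 0 < g r k × g r k ≤ n

ListFilling : List ℕ → ℕ → (ℕ → ℕ → ℕ) → Set
ListFilling α = Filling (length α) (at α)

valid⁻ : ∀ {n} α T → InRange n α (entry T) → validFillingᵇ α T ≡ true → ListFilling α n (entry T)
valid⁻ α T range valid
  with rows , valid′ ← ∧-true⁻ {rowsWeaklyDecreaseᵇ α T} valid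
  with col , valid″ ← ∧-true⁻ {firstColumnIncreasesᵇ α T} valid′
  with tA , tB ← ∧-true⁻ {typeAOKᵇ α T} valid″ = record
  { positive = λ r<ℓ k<a → proj₁ (range r<ℓ k<a)
  ; bounded  = λ r<ℓ k<a → proj₂ (range r<ℓ k<a)
  ; row-step = λ {r} {k} r<ℓ sk<a → ≤ᵇ≡true⇒≤
      (if-true⁻ (suc k <ᵇ at α r) (allBelow⁻ (at α r) _ (allBelow⁻ (length α) _ rows r<ℓ) (<⇒≤ sk<a)) (<⇒<ᵇ≡true sk<a))
  ; col-step = λ {r} sr<ℓ → <ᵇ≡true⇒< (if-true⁻ (suc r <ᵇ length α) (allBelow⁻ (length α) _ col (<⇒≤ sr<ℓ)) (<⇒<ᵇ≡true sr<ℓ))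
  ; typeA    = λ {i} {i′} {k} i<i′ i′<ℓ ai′≤ai sk<a′ → inversion⁻ _ _ _
      (if-true⁻ ((i <ᵇ i′) ∧ (at α i′ ≤ᵇ at α i) ∧ (suc k <ᵇ at α i) ∧ (suc k <ᵇ at α i′))
        (allBelow⁻ (at α i) _ (allBelow⁻ (length α) _ (allBelow⁻ (length α) _ tA (<-trans i<i′ i′<ℓ)) i′<ℓ)
                  (<⇒≤ (<-≤-trans sk<a′ ai′≤ai)))
        (∧-true⁺ (<⇒<ᵇ≡true i<i′) (∧-true⁺ (≤⇒≤ᵇ≡true ai′≤ai)
          (∧-true⁺ (<⇒<ᵇ≡true (<-≤-trans sk<a′ ai′≤ai)) (<⇒<ᵇ≡true sk<a′)))))
  ; typeB    = λ {i} {i′} {k} i<i′ i′<ℓ ai<ai′ k<a sk<a′ → inversion⁻ _ _ _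
      (if-true⁻ ((i <ᵇ i′) ∧ (at α i <ᵇ at α i′) ∧ (k <ᵇ at α i) ∧ (suc k <ᵇ at α i′))
        (allBelow⁻ (at α i′) _ (allBelow⁻ (length α) _ (allBelow⁻ (length α) _ tB (<-trans i<i′ i′<ℓ)) i′<ℓ)
                  (<⇒≤ sk<a′))
        (∧-true⁺ (<⇒<ᵇ≡true i<i′) (∧-true⁺ (<⇒<ᵇ≡true ai<ai′)
          (∧-true⁺ (<⇒<ᵇ≡true k<a) (<⇒<ᵇ≡true sk<a′)))))
  }

valid⁺ : ∀ {n} α T → ListFilling α n (entry T) → validFillingᵇ α T ≡ true
valid⁺ α T F = ∧-true⁺ rows (∧-true⁺ col (∧-true⁺ tA tB))
  where
  open Filling F
  rows : rowsWeaklyDecreaseᵇ α T ≡ true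
  rows = allBelow⁺ (length α) _ λ r r<ℓ → allBelow⁺ (at α r) _ λ k _ →
    if-true⁺ {suc k <ᵇ at α r} λ sk<a → ≤⇒≤ᵇ≡true (row-step {r} {k} r<ℓ (<ᵇ≡true⇒< sk<a))
  col : firstColumnIncreasesᵇ α T ≡ true
  col = allBelow⁺ (length α) _ λ r _ →
    if-true⁺ {suc r <ᵇ length α} λ sr<ℓ → <⇒<ᵇ≡true (col-step {r} (<ᵇ≡true⇒< sr<ℓ))
  tA : typeAOKᵇ α T ≡ true
  tA = allBelow⁺ (length α) _ λ i _ → allBelow⁺ (length α) _ λ i′ i′<ℓ → allBelow⁺ (at α i) _ λ k _ →
    if-true⁺ {(i <ᵇ i′) ∧ (at α i′ ≤ᵇ at α i) ∧ (suc k <ᵇ at α i) ∧ (suc k <ᵇ at α i′)} λ c →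
      let i<i′ , c₁ = ∧-true⁻ {i <ᵇ i′} c
          a′≤a , c₂ = ∧-true⁻ {at α i′ ≤ᵇ at α i} c₁
          _ , sk<a′ = ∧-true⁻ {suc k <ᵇ at α i} c₂
      in inversion⁺ _ _ _ (typeA {i} {i′} {k} (<ᵇ≡true⇒< i<i′) i′<ℓ (≤ᵇ≡true⇒≤ a′≤a) (<ᵇ≡true⇒< sk<a′))
  tB : typeBOKᵇ α T ≡ true
  tB = allBelow⁺ (length α) _ λ i _ → allBelow⁺ (length α) _ λ i′ i′<ℓ → allBelow⁺ (at α i′) _ λ k _ →
    if-true⁺ {(i <ᵇ i′) ∧ (at α i <ᵇ at α i′) ∧ (k <ᵇ at α i) ∧ (suc k <ᵇ at α i′)} λ c →
      let i<i′ , c₁ = ∧-true⁻ {i <ᵇ i′} c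
          a<a′ , c₂ = ∧-true⁻ {at α i <ᵇ at α i′} c₁
          k<a , sk<a′ = ∧-true⁻ {k <ᵇ at α i} c₂
      in inversion⁺ _ _ _ (typeB {i} {i′} {k} (<ᵇ≡true⇒< i<i′) i′<ℓ (<ᵇ≡true⇒< a<a′) (<ᵇ≡true⇒< k<a) (<ᵇ≡true⇒< sk<a′))

-- The right notion of equality for fillings given as functions, whose values off the diagram carry
-- no meaning.
Agree : ℕ → (ℕ → ℕ) → (ℕ → ℕ → ℕ) → (ℕ → ℕ → ℕ) → Set
Agree ℓ a g h = ∀ {r k} → r < ℓ → k < a r → g r k ≡ h r k

Filling-resp-Agree : ∀ {ℓ a n g h} → (∀ {r} → r < ℓ → 0 < a r) → Agree ℓ a g h →
                     Filling ℓ a n g → Filling ℓ a n h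
Filling-resp-Agree a-pos g≈h F = record
  { positive = λ r<ℓ k<a → subst (0 <_) (g≈h r<ℓ k<a) (positive r<ℓ k<a)
  ; bounded  = λ r<ℓ k<a → subst (_≤ _) (g≈h r<ℓ k<a) (bounded r<ℓ k<a)
  ; row-step = λ r<ℓ sk<a → subst₂ _≤_ (g≈h r<ℓ sk<a) (g≈h r<ℓ (<⇒≤ sk<a)) (row-step r<ℓ sk<a)
  ; col-step = λ sr<ℓ → subst₂ _<_ (g≈h (<⇒≤ sr<ℓ) (a-pos (<⇒≤ sr<ℓ))) (g≈h sr<ℓ (a-pos sr<ℓ)) (col-step sr<ℓ)
  ; typeA    = λ i<i′ i′<ℓ ai′≤ai sk<a′ y≤z →
      let i<ℓ = <-trans i<i′ i′<ℓ; sk<a = <-≤-trans sk<a′ ai′≤ai; y = g≈h i′<ℓ sk<a′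
      in subst₂ _<_ y (g≈h i<ℓ sk<a) (typeA i<i′ i′<ℓ ai′≤ai sk<a′
           (subst₂ _≤_ (sym y) (sym (g≈h i<ℓ (<⇒≤ sk<a))) y≤z))
  ; typeB    = λ i<i′ i′<ℓ ai<ai′ k<a sk<a′ y≤z →
      let y = g≈h (<-trans i<i′ i′<ℓ) k<a
      in subst₂ _<_ y (g≈h i′<ℓ sk<a′) (typeB i<i′ i′<ℓ ai<ai′ k<a sk<a′
           (subst₂ _≤_ (sym y) (sym (g≈h i′<ℓ (<⇒≤ sk<a′))) y≤z))
  }
  where open Filling F

fill : List ℕ → (ℕ → ℕ → ℕ) → List (List ℕ)
fill []      g = []
fill (a ∷ α) g = applyUpTo (g 0) a ∷ fill α (g ∘ suc)

entry-fill : ∀ α g → Agree (length α) (at α) (entry (fill α g)) g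
entry-fill (a ∷ α) g {zero}  _   k<a = at-applyUpTo a (g 0) k<a
entry-fill (a ∷ α) g {suc r} r<ℓ k<a = entry-fill α (g ∘ suc) (s≤s⁻¹ r<ℓ) k<a

fill-cong : ∀ α {g h} → Agree (length α) (at α) g h → fill α g ≡ fill α h
fill-cong []      g≈h = refl
fill-cong (a ∷ α) g≈h =
  cong₂ _∷_ (applyUpTo-cong a (λ _ k<a → g≈h z<s k<a)) (fill-cong α (λ r<ℓ k<a → g≈h (s<s r<ℓ) k<a))

concatMap-map : ∀ {A : Set} (vs : List A) ws →
  concatMap (λ v → map (v ∷_) ws) vs ≡ cartesianProductWith List._∷_ vs ws
concatMap-map []       ws = refl
concatMap-map (v ∷ vs) ws = cong (map (v List.∷_) ws ++_) (concatMap-map vs ws)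

∈-prefix⁺ : ∀ {A : Set} {v : A} {w vs ws} → v ∈ vs → w ∈ ws → v ∷ w ∈ concatMap (λ v → map (v ∷_) ws) vs
∈-prefix⁺ {vs = vs} {ws} v∈vs w∈ws =
  subst (_ ∈_) (sym (concatMap-map vs ws)) (∈-cartesianProductWith⁺ List._∷_ v∈vs w∈ws)

∈-prefix⁻ : ∀ {A : Set} {u : List A} vs ws → u ∈ concatMap (λ v → map (v ∷_) ws) vs →
            ∃ λ v → ∃ λ w → v ∈ vs × w ∈ ws × u ≡ v ∷ w
∈-prefix⁻ vs ws u∈ = ∈-cartesianProductWith⁻ List._∷_ vs ws (subst (_ ∈_) (concatMap-map vs ws) u∈)

Unique-prefix : ∀ {A : Set} {vs : List A} {ws} → Unique vs → Unique ws → Unique (concatMap (λ v → map (v ∷_) ws) vs)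
Unique-prefix {vs = vs} {ws} uvs uws =
  subst Unique (sym (concatMap-map vs ws)) (UniqueP.cartesianProductWith⁺ List._∷_ ∷-injective uvs uws)

∈-values⁺ : ∀ {n v} → 0 < v → v ≤ n → v ∈ values n
∈-values⁺ {v = suc v} _ v<n = ∈-map⁺ suc (∈-applyUpTo⁺ id v<n)

∈-values⁻ : ∀ {n v} → v ∈ values n → 0 < v × v ≤ n
∈-values⁻ v∈ with u , u∈ , refl ← ∈-map⁻ suc v∈ with i , i<n , refl ← ∈-applyUpTo⁻ id u∈ = z<s , i<n

Unique-values : ∀ n → Unique (values n)
Unique-values n = UniqueP.map⁺ suc-injective (UniqueP.upTo⁺ n)

wordsOfLength⁻ : ∀ n k {w} → w ∈ wordsOfLength n k →
  length w ≡ k × (∀ {i} → i < k → 0 < at w i × at w i ≤ n)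
wordsOfLength⁻ n zero    (here refl) = refl , λ ()
wordsOfLength⁻ n (suc k) w∈ with v , w , v∈ , w∈′ , refl ← ∈-prefix⁻ (values n) (wordsOfLength n k) w∈
  with len , range ← wordsOfLength⁻ n k w∈′ =
  cong suc len , λ { {zero} _ → ∈-values⁻ v∈ ; {suc i} i<k → range (s≤s⁻¹ i<k) }

wordsOfLength⁺ : ∀ n k f → (∀ {i} → i < k → 0 < f i × f i ≤ n) → applyUpTo f k ∈ wordsOfLength n k
wordsOfLength⁺ n zero    f range = here refl
wordsOfLength⁺ n (suc k) f range =
  ∈-prefix⁺ (∈-values⁺ (proj₁ (range z<s)) (proj₂ (range z<s)))
            (wordsOfLength⁺ n k (f ∘ suc) (λ i<k → range (s<s i<k)))

Unique-wordsOfLength : ∀ n k → Unique (wordsOfLength n k)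
Unique-wordsOfLength n zero    = [] ∷ []
Unique-wordsOfLength n (suc k) = Unique-prefix (Unique-values n) (Unique-wordsOfLength n k)

allFillings⁻ : ∀ α n {T} → T ∈ allFillings α n → T ≡ fill α (entry T) × InRange n α (entry T)
allFillings⁻ []      n (here refl) = refl , λ ()
allFillings⁻ (a ∷ α) n T∈ with w , T , w∈ , T∈′ , refl ← ∈-prefix⁻ (wordsOfLength n a) (allFillings α n) T∈
  with len , wrange ← wordsOfLength⁻ n a w∈
  with eq , range ← allFillings⁻ α n T∈′ =
  cong₂ _∷_ (sym (trans (cong (applyUpTo (at w)) (sym len)) (applyUpTo-at w))) eq ,
  λ { {zero} _ k<a → wrange k<a ; {suc r} r<ℓ k<a → range (s≤s⁻¹ r<ℓ) k<a }

allFillings⁺ : ∀ α n g → InRange n α g → fill α g ∈ allFillings α n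
allFillings⁺ []      n g range = here refl
allFillings⁺ (a ∷ α) n g range =
  ∈-prefix⁺ (wordsOfLength⁺ n a (g 0) (λ k<a → range z<s k<a))
            (allFillings⁺ α n (g ∘ suc) (λ r<ℓ k<a → range (s<s r<ℓ) k<a))

Unique-allFillings : ∀ α n → Unique (allFillings α n)
Unique-allFillings []      n = [] ∷ []
Unique-allFillings (a ∷ α) n = Unique-prefix (Unique-wordsOfLength n a) (Unique-allFillings α n)

count-++ : ∀ {A : Set} (p : A → Bool) xs ys → count p (xs ++ ys) ≡ count p xs + count p ys
count-++ p []       ys = refl
count-++ p (x ∷ xs) ys with p x
... | true  = cong suc (count-++ p xs ys)
... | false = count-++ p xs ys

count-applyUpTo : ∀ v f n → count (λ r → v ≡ᵇ r) (applyUpTo f n) ≡ ∑ n (λ k → 𝟙 (v ≟ f k))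
count-applyUpTo v f zero    = refl
count-applyUpTo v f (suc n) with v ≡ᵇ f 0
... | true  = cong suc (count-applyUpTo v (f ∘ suc) n)
... | false = count-applyUpTo v (f ∘ suc) n

count-fill : ∀ α g v →
  count (λ r → v ≡ᵇ r) (concatMap (λ r → r) (fill α g)) ≡ occurrences (length α) (at α) g v
count-fill []      g v = refl
count-fill (a ∷ α) g v = trans (count-++ _ (applyUpTo (g 0) a) _)
  (cong₂ _+_ (count-applyUpTo v (g 0) a) (count-fill α (g ∘ suc) v))

content-fill : ∀ n α g → content n (fill α g) ≡ applyUpTo (occurrences (length α) (at α) g ∘ suc) n
content-fill n α g = begin
  map c (map suc (applyUpTo id n))   ≡⟨ cong (map c) (map-applyUpTo id suc n) ⟩
  map c (applyUpTo suc n)            ≡⟨ map-applyUpTo suc c n ⟩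
  applyUpTo (c ∘ suc) n              ≡⟨ applyUpTo-cong n (λ v _ → count-fill α g (suc v)) ⟩
  applyUpTo (occurrences (length α) (at α) g ∘ suc) n ∎
  where
  open ≡-Reasoning
  c : ℕ → ℕ
  c v = count (λ r → v ≡ᵇ r) (concatMap (λ r → r) (fill α g))

eqList⁻ : ∀ xs ys → eqListᵇ xs ys ≡ true → xs ≡ ys
eqList⁻ []       []       _  = refl
eqList⁻ (x ∷ xs) (y ∷ ys) eq with p , q ← ∧-true⁻ {x ≡ᵇ y} eq =
  cong₂ _∷_ (≡ᵇ⇒≡ x y (≡true⇒T p)) (eqList⁻ xs ys q)

eqList⁺ : ∀ xs → eqListᵇ xs xs ≡ true
eqList⁺ []       = refl
eqList⁺ (x ∷ xs) = ∧-true⁺ (T⇒≡true (≡⇒≡ᵇ x x refl)) (eqList⁺ xs)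

Weight : List ℕ → ∀ {n} → (ℕ → ℕ → ℕ) → Vec ℕ n → Set
Weight α {n} g e = ∀ v → v < n → occurrences (length α) (at α) g (suc v) ≡ at (toList e) v

counted : List ℕ → ∀ {n} → Vec ℕ n → List (List ℕ) → Bool
counted α {n} e T = validFillingᵇ α T ∧ eqListᵇ (content n T) (toList e)

toList-applyUpTo : ∀ {n} (e : Vec ℕ n) → applyUpTo (at (toList e)) n ≡ toList e
toList-applyUpTo e = trans (cong (applyUpTo (at (toList e))) (sym (VecP.length-toList e))) (applyUpTo-at (toList e))

counted⁻ : ∀ α {n} (e : Vec ℕ n) {T} → T ∈ allFillings α n → counted α e T ≡ true →
           ListFilling α n (entry T) × Weight α (entry T) e
counted⁻ α {n} e {T} T∈ c
  with eq , range ← allFillings⁻ α n T∈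
  with valid , cont ← ∧-true⁻ {validFillingᵇ α T} c =
  valid⁻ α T range valid , λ v v<n → trans (sym (at-applyUpTo n _ v<n)) (cong (λ l → at l v) (begin
    applyUpTo (occurrences (length α) (at α) (entry T) ∘ suc) n ≡⟨ content-fill n α (entry T) ⟨
    content n (fill α (entry T))                                 ≡⟨ cong (content n) eq ⟨
    content n T                                                  ≡⟨ eqList⁻ _ _ cont ⟩
    toList e                                                     ∎))
  where open ≡-Reasoning

counted⁺ : ∀ α {n} (e : Vec ℕ n) {g} → IsComposition α → ListFilling α n g → Weight α g e →
           fill α g ∈ allFillings α n × counted α e (fill α g) ≡ true
counted⁺ α {n} e {g} comp F weight =
  allFillings⁺ α n g (λ r<ℓ k<a → Filling.positive F r<ℓ k<a , Filling.bounded F r<ℓ k<a) ,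
  ∧-true⁺ (valid⁺ α (fill α g) (Filling-resp-Agree (at-All comp) (λ r<ℓ k<a → sym (entry-fill α g r<ℓ k<a)) F))
          (subst (λ l → eqListᵇ l (toList e) ≡ true)
                 (sym (trans (content-fill n α g) (trans (applyUpTo-cong n weight) (toList-applyUpTo e))))
                 (eqList⁺ (toList e)))

count-positive⁻ : ∀ {A : Set} (p : A → Bool) xs → 0 < count p xs → ∃ λ x → x ∈ xs × p x ≡ true
count-positive⁻ p (x ∷ xs) 0<c with p x in eq
... | true  = x , here refl , eq
... | false with y , y∈ , py ← count-positive⁻ p xs 0<c = y , there y∈ , py

count-positive⁺ : ∀ {A : Set} (p : A → Bool) {xs x} → x ∈ xs → p x ≡ true → 0 < count p xs
count-positive⁺ p (here refl) px rewrite px = z<s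
count-positive⁺ p {y ∷ xs} (there x∈) px with p y
... | true  = z<s
... | false = count-positive⁺ p x∈ px

-- A relation stands in for an injection. A partner of the head of the list is removed from `ys`;
-- injectivity ensures that the partners of the remaining elements survive the removal.
count-≤ : ∀ {A B : Set} (p : A → Bool) (q : B → Bool) (R : A → B → Set) xs ys → Unique xs →
  (∀ x → x ∈ xs → p x ≡ true → ∃ λ y → y ∈ ys × q y ≡ true × R x y) →
  (∀ {x x′ y} → x ∈ xs → x′ ∈ xs → p x ≡ true → p x′ ≡ true → R x y → R x′ y → x ≡ x′) →
  count p xs ≤ count q ys
count-≤ p q R []       ys _          _     _   = z≤n
count-≤ p q R (x ∷ xs) ys (x∉ ∷ uxs) image inj with p x in px
... | false = count-≤ p q R xs ys uxs (λ x x∈ → image x (there x∈)) (λ x∈ x∈′ → inj (there x∈) (there x∈′))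
... | true with y , y∈ , qy , Rxy ← image x (here refl) px
  with as , bs , refl ← ∈-∃++ y∈ = ≤-trans (s≤s rest) (≤-reflexive (sym total))
  where
  total : count q (as ++ [ y ] ++ bs) ≡ suc (count q (as ++ bs))
  total rewrite count-++ q as (y ∷ bs) | count-++ q as bs | qy = +-suc (count q as) (count q bs)
  remove : ∀ {z} → z ≢ y → z ∈ as ++ [ y ] ++ bs → z ∈ as ++ bs
  remove z≢y z∈ with ∈-++⁻ as z∈
  ... | inj₁ z∈as         = ∈-++⁺ˡ z∈as
  ... | inj₂ (here z≡y)   = contradiction z≡y z≢y
  ... | inj₂ (there z∈bs) = ∈-++⁺ʳ as z∈bs
  rest : count p xs ≤ count q (as ++ bs)
  rest = count-≤ p q R xs (as ++ bs) uxs image′ (λ x∈ x∈′ → inj (there x∈) (there x∈′))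
    where
    image′ : ∀ x → x ∈ xs → p x ≡ true → ∃ λ y → y ∈ as ++ bs × q y ≡ true × R x y
    image′ x′ x′∈ px′ with y′ , y′∈ , qy′ , Rxy′ ← image x′ (there x′∈) px′ =
      y′ , remove (λ { refl → All.lookup x∉ x′∈ (inj (here refl) (there x′∈) px px′ Rxy Rxy′) }) y′∈ , qy′ , Rxy′

QS-positive⁻ : ∀ α {n} (e : Vec ℕ n) → 0 < QS α n e → ∃ λ g → ListFilling α n g × Weight α g e
QS-positive⁻ α {n} e 0<c with T , T∈ , c ← count-positive⁻ (counted α e) (allFillings α n) 0<c =
  entry T , counted⁻ α e T∈ c

QS-positive⁺ : ∀ α {n} (e : Vec ℕ n) {g} → IsComposition α → ListFilling α n g → Weight α g e → 0 < QS α n e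
QS-positive⁺ α e comp F weight with T∈ , c ← counted⁺ α e comp F weight = count-positive⁺ (counted α e) T∈ c

-- The partner of `g` is computed from a proof that `g` is a filling. The relation `R` retains what
-- determines `g`, so that injectivity speaks of entries only.
QS-≤ : ∀ α γ {n} (e e′ : Vec ℕ n) (R : (ℕ → ℕ → ℕ) → (ℕ → ℕ → ℕ) → Set) → IsComposition γ →
  (∀ {g} → ListFilling α n g → Weight α g e → ∃ λ g′ → ListFilling γ n g′ × Weight γ g′ e′ × R g g′) →
  (∀ {g h g′ h′} → ListFilling α n g → ListFilling α n h → R g g′ → R h h′ →
     Agree (length γ) (at γ) g′ h′ → Agree (length α) (at α) g h) →
  QS α n e ≤ QS γ n e′
QS-≤ α γ {n} e e′ R comp image inj = count-≤ (counted α e) (counted γ e′)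
  (λ T U → ∃ λ g′ → U ≡ fill γ g′ × R (entry T) g′) _ _ (Unique-allFillings α n)
  (λ T T∈ c → let F , weight = counted⁻ α e T∈ c
                  g′ , F′ , weight′ , r = image F weight
                  U∈ , c′ = counted⁺ γ e′ comp F′ weight′
              in fill γ g′ , U∈ , c′ , g′ , refl , r)
  λ {T} {T₁} T∈ T₁∈ c c₁ (g′ , eq , r) (h′ , eq₁ , r₁) →
    let F , _ = counted⁻ α e T∈ c
        F₁ , _ = counted⁻ α e T₁∈ c₁
    in trans (proj₁ (allFillings⁻ α n T∈)) (trans
         (fill-cong α (inj F F₁ r r₁ (λ {s} {k} s<ℓ k<a →
           trans (sym (entry-fill γ g′ s<ℓ k<a))
                 (trans (cong (λ U → entry U s k) (trans (sym eq) eq₁)) (entry-fill γ h′ s<ℓ k<a)))))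
         (sym (proj₁ (allFillings⁻ α n T₁∈))))

-- The exponent vector is chosen as the content of the given filling, which makes its coefficient
-- positive.
dual-from-QS : ∀ n α γ → IsComposition α → (∀ e → 0 < QS α n e → 0 < QS γ n (Vec.reverse e)) →
               Dual n (length α) (at α) (length γ) (at γ)
dual-from-QS n α γ comp h {g} F = g′ , F′ , λ v v<n →
  let s = n ∸ suc v; eq = m+[n∸m]≡n v<n in begin
    occurrences (length γ) (at γ) g′ (suc v)   ≡⟨ weight′ v v<n ⟩
    at (toList (Vec.reverse e)) v              ≡⟨ at-Vec-reverse e v s eq ⟩
    at (toList e) s                            ≡⟨ at-vec n _ (suc-sum-< s v (suc-sum-comm v s eq)) ⟩
    occurrences (length α) (at α) g (suc s)    ≡⟨ cong (occurrences (length α) (at α) g) (suc-sum-∸ v s eq) ⟨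
    occurrences (length α) (at α) g (n ∸ v)    ∎
  where
  open ≡-Reasoning
  e : Vec ℕ n
  e = vec n (occurrences (length α) (at α) g ∘ suc)
  dual-filling : ∃ λ g′ → ListFilling γ n g′ × Weight γ g′ (Vec.reverse e)
  dual-filling = QS-positive⁻ γ (Vec.reverse e)
    (h e (QS-positive⁺ α e comp F (λ _ v<n → sym (at-vec n _ v<n))))
  g′ : ℕ → ℕ → ℕ
  g′ = proj₁ dual-filling
  F′ : ListFilling γ n g′
  F′ = proj₁ (proj₂ dual-filling)
  weight′ : Weight γ g′ (Vec.reverse e)
  weight′ = proj₂ (proj₂ dual-filling)

-- As many variables as parts

module _ {n a g} (F : Filling n a n g) (a-pos : ∀ {r} → r < n → 0 < a r)
  (ascent≤1 : ∀ {r} → suc r < n → a (suc r) ≤ suc (a r)) where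
  open Filling F
  open FillingProperties F

  private
    -- A discrete intermediate value theorem: going up from row w to row r, lengths rise by at most
    -- 1 per row and so hit k + 1.
    intermediate : ∀ {w k} r → w < r → r < n → a w ≤ k → suc k < a r →
                   ∃ λ s → w < s × s < r × a s ≡ suc k
    intermediate {w} {k} (suc r) w<sr sr<n aw≤k sk<a with a r ≟ suc k | m≤n⇒m<n∨m≡n (s≤s⁻¹ w<sr)
    ... | _      | inj₂ refl = contradiction (≤-trans sk<a (≤-trans (ascent≤1 sr<n) (s≤s aw≤k))) (<-irrefl refl)
    ... | yes eq | inj₁ w<r  = r , w<r , ≤-refl , eq
    ... | no  ≢  | inj₁ w<r
      with s , w<s , s<r , eq ← intermediate r w<r (<⇒≤ sr<n) aw≤k
             (≤∧≢⇒< (s≤s⁻¹ (≤-trans sk<a (ascent≤1 sr<n))) (≢ ∘ sym)) =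
      s , w<s , m<n⇒m<1+n s<r , eq

    head : ∀ {r} → r < n → g r 0 ≡ suc r
    head {r} r<n = ≤-antisym
      (+-cancelʳ-≤ (n ∸ suc r) (g r 0) (suc r)
        (≤-trans (col-upper r (n ∸ suc r) (λ i<n → bounded i<n (a-pos i<n)) (m+[n∸m]≡n r<n))
                 (≤-reflexive (sym (m+[n∸m]≡n r<n)))))
      (col-lower r (λ s<n → positive s<n (a-pos s<n)) r<n)

  -- Suppose the entry in column k + 1 is w + 1 with w < r. If row w reaches column k, it has w + 1
  -- there by induction, against `no-descent`. If not, some row s strictly between has length k + 1
  -- and ends in s + 1, and type B forces s + 1 < w + 1.
  rigid : ∀ {r} k → r < n → k < a r → g r k ≡ suc r
  rigid zero r<n _ = head r<n
  rigid {r} (suc k) r<n sk<a with g r (suc k) in eq | positive r<n sk<a | row-step r<n sk<a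
  ... | suc w | _ | step with m≤n⇒m<n∨m≡n (s≤s⁻¹ (subst (suc w ≤_) (rigid k r<n (<⇒≤ sk<a)) step))
  ...   | inj₂ refl = refl
  ...   | inj₁ w<r with k <? a w
  ...     | yes k<aw = contradiction (trans eq (sym gwk))
      (no-descent w<r r<n sk<a k<aw (subst₂ _≤_ (sym gwk) (sym (rigid k r<n (<⇒≤ sk<a))) (s≤s (<⇒≤ w<r))))
    where
    gwk : g w k ≡ suc w
    gwk = rigid k (<-trans w<r r<n) k<aw
  ...     | no  k≮aw with s , w<s , s<r , as≡sk ← intermediate r w<r r<n (≮⇒≥ k≮aw) sk<a =
    contradiction
      (subst₂ _<_ (rigid k (<-trans s<r r<n) (≤-reflexive (sym as≡sk))) eq
        (longer-above-next s<r r<n (subst (_< a r) (sym as≡sk) sk<a) (≤-reflexive (sym as≡sk)) sk<a))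
      (≤⇒≯ (s≤s (<⇒≤ w<s)))

-- An injection suffices: for a shape and for its reverse it gives the two opposite inequalities
-- between coefficients.
record ComplementingInjection (n ℓ : ℕ) (a a′ : ℕ → ℕ) : Set₁ where
  field
    Related   : (ℕ → ℕ → ℕ) → (ℕ → ℕ → ℕ) → Set
    image     : ∀ {g} → Filling ℓ a n g → ∃ λ g′ → Filling ℓ a′ n g′ ×
                (∀ v → v < n → occurrences ℓ a′ g′ (suc v) ≡ occurrences ℓ a g (n ∸ v)) × Related g g′
    injective : ∀ {g h g′ h′} → Filling ℓ a n g → Filling ℓ a n h → Related g g′ → Related h h′ →
                Agree ℓ a′ g′ h′ → Agree ℓ a g h

QS-reverse-≤ : ∀ {n} α (e : Vec ℕ n) → IsComposition (reverse α) →
  ComplementingInjection n (length α) (at α) (at (reverse α)) →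
  QS α n e ≤ QS (reverse α) n (Vec.reverse e)
QS-reverse-≤ {n} α e comp I = QS-≤ α (reverse α) e (Vec.reverse e) Related comp image′
  (λ {g} {h} {g′} {h′} F G r r′ agree →
    injective F G r r′ (subst (λ ℓ → Agree ℓ (at (reverse α)) g′ h′) (length-reverse α) agree))
  where
  open ComplementingInjection I
  image′ : ∀ {g} → ListFilling α n g → Weight α g e →
           ∃ λ g′ → ListFilling (reverse α) n g′ × Weight (reverse α) g′ (Vec.reverse e) × Related g g′
  image′ {g} F weight with g′ , F′ , occ , r ← image F =
    g′ , subst (λ ℓ → Filling ℓ (at (reverse α)) n g′) (sym (length-reverse α)) F′ , weight′ , r
    where
    open ≡-Reasoning
    weight′ : Weight (reverse α) g′ (Vec.reverse e)
    weight′ v v<n = let s = n ∸ suc v; eq = m+[n∸m]≡n v<n in begin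
      occurrences (length (reverse α)) (at (reverse α)) g′ (suc v)
        ≡⟨ cong (λ ℓ → occurrences ℓ (at (reverse α)) g′ (suc v)) (length-reverse α) ⟩
      occurrences (length α) (at (reverse α)) g′ (suc v)  ≡⟨ occ v v<n ⟩
      occurrences (length α) (at α) g (n ∸ v)
        ≡⟨ cong (occurrences (length α) (at α) g) (suc-sum-∸ v s eq) ⟩
      occurrences (length α) (at α) g (suc s)
        ≡⟨ weight s (suc-sum-< s v (suc-sum-comm v s eq)) ⟩
      at (toList e) s                                     ≡⟨ at-Vec-reverse e v s eq ⟨
      at (toList (Vec.reverse e)) v                       ∎

occurrences-cong : ∀ ℓ a {g h} v → Agree ℓ a g h → occurrences ℓ a g v ≡ occurrences ℓ a h v
occurrences-cong ℓ a v g≈h = cells-cong ℓ a (λ r k r<ℓ k<a → cong (λ x → 𝟙 (v ≟ x)) (g≈h r<ℓ k<a))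

-- By `rigid` all fillings of the shape agree, so the trivial relation is already injective.
rigid-injection : ∀ {n a a′} → (∀ {r} → r < n → 0 < a r) → (∀ {r} → suc r < n → a (suc r) ≤ suc (a r)) →
  (∀ r s → suc (r + s) ≡ n → a′ r ≡ a s) → ComplementingInjection n n a a′
rigid-injection {n} {a} {a′} a-pos ascent≤1 reversed = record
  { Related   = λ _ _ → ⊤
  ; image     = λ {g} F → (λ r _ → suc r) , identity-rows a′ ≤-refl , occ F , tt
  ; injective = λ F G _ _ _ {r} {k} r<n k<a →
      trans (rigid F a-pos ascent≤1 k r<n k<a) (sym (rigid G a-pos ascent≤1 k r<n k<a))
  }
  where
  occ : ∀ {g} → Filling n a n g → ∀ v → v < n →
        occurrences n a′ (λ r _ → suc r) (suc v) ≡ occurrences n a g (n ∸ v)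
  occ {g} F v v<n = let s = n ∸ suc v; eq = m+[n∸m]≡n v<n in begin
    occurrences n a′ (λ r _ → suc r) (suc v) ≡⟨ occurrences-identity n a′ v<n ⟩
    a′ v                                     ≡⟨ reversed v s eq ⟩
    a s                                      ≡⟨ occurrences-identity n a (suc-sum-< s v (suc-sum-comm v s eq)) ⟨
    occurrences n a (λ r _ → suc r) (suc s)
      ≡⟨ occurrences-cong n a (suc s) (λ {r} {k} r<n k<a → sym (rigid F a-pos ascent≤1 k r<n k<a)) ⟩
    occurrences n a g (suc s)                ≡⟨ cong (occurrences n a g) (suc-sum-∸ v s eq) ⟨
    occurrences n a g (n ∸ v)                ∎
    where open ≡-Reasoning

-- Rectangles

tally : (ℕ → ℕ) → List ℕ → ℕ
tally φ xs = sum (map φ xs)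

tally-↭ : ∀ φ {xs ys} → xs ↭ ys → tally φ xs ≡ tally φ ys
tally-↭ φ = sum-↭ ∘ ↭P.map⁺ φ

tally-applyUpTo : ∀ φ n f → tally φ (applyUpTo f n) ≡ ∑ n (φ ∘ f)
tally-applyUpTo φ zero    f = refl
tally-applyUpTo φ (suc n) f = cong (φ (f 0) +_) (tally-applyUpTo φ n (f ∘ suc))

atLeast : ℕ → List ℕ → ℕ
atLeast t = tally (λ x → 𝟙 (t ≤? x))

atLeast-≤-length : ∀ t xs → atLeast t xs ≤ length xs
atLeast-≤-length t []       = z≤n
atLeast-≤-length t (x ∷ xs) = +-mono-≤ (𝟙≤1 (t ≤? x)) (atLeast-≤-length t xs)

atLeast-All : ∀ t {xs} → All (t ≤_) xs → atLeast t xs ≡ length xs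
atLeast-All t []                  = refl
atLeast-All t {x ∷ _} (t≤x ∷ t≤xs) = cong₂ _+_ (𝟙-yes (t ≤? x) t≤x) (atLeast-All t t≤xs)

tally-mono : ∀ {φ ψ} xs → All (λ x → φ x ≤ ψ x) xs → tally φ xs ≤ tally ψ xs
tally-mono []       []       = z≤n
tally-mono (x ∷ xs) (p ∷ ps) = +-mono-≤ p (tally-mono xs ps)

-- Adjacent columns of a rectangular filling, read from bottom to top: by the type A condition
-- each entry is the largest one ≤ its left neighbour among itself and the entries above it.
data Step : List ℕ → List ℕ → Set where
  []   : Step [] []
  cons : ∀ {z x zs xs} → x ≤ z → All (λ y → y ≤ z → y < x) xs → Step zs xs → Step (z ∷ zs) (x ∷ xs)

Step-applyUpTo : ∀ n f h → (∀ {i} → i < n → h i ≤ f i) →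
  (∀ {i j} → i < j → j < n → h j ≤ f i → h j < h i) → Step (applyUpTo f n) (applyUpTo h n)
Step-applyUpTo zero    f h le tA = []
Step-applyUpTo (suc n) f h le tA =
  cons (le z<s) (AllP.applyUpTo⁺₁ (h ∘ suc) n (λ i<n → tA z<s (s<s i<n)))
    (Step-applyUpTo n (f ∘ suc) (h ∘ suc) (λ i<n → le (s<s i<n)) (λ i<j j<n → tA (s<s i<j) (s<s j<n)))

Step-≤ : ∀ {zs xs} → Step zs xs → ∀ {i} → i < length xs → at xs i ≤ at zs i
Step-≤ (cons x≤z _ S) {zero}  _   = x≤z
Step-≤ (cons _ _ S)   {suc i} i<l = Step-≤ S (s≤s⁻¹ i<l)

Step-typeA : ∀ {zs xs} → Step zs xs → ∀ {i j} → i < j → j < length xs → at xs j ≤ at zs i → at xs j < at xs i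
Step-typeA (cons _ above S) {zero}  {suc j} _   j<l = at-All above (s≤s⁻¹ j<l)
Step-typeA (cons _ _ S)     {suc i} {suc j} i<j j<l = Step-typeA S (s≤s⁻¹ i<j) (s≤s⁻¹ j<l)

head-maximal : ∀ {z u v us vs} → v ∷ vs ↭ u ∷ us → v ≤ z → All (λ w → w ≤ z → w < u) us → v ≤ u
head-maximal q v≤z above with ↭P.∈-resp-↭ q (here refl)
... | here refl = ≤-refl
... | there v∈  = <⇒≤ (All.lookup above v∈ v≤z)

-- Given the left neighbour z, the bottom entry can only be the largest available entry ≤ z, so the
-- set of entries determines the order.
Step-unique : ∀ {zs xs ys} → Step zs xs → Step zs ys → xs ↭ ys → xs ≡ ys
Step-unique [] [] _ = refl
Step-unique (cons {x = x} {xs = xs} x≤z above S) (cons {x = y} {xs = ys} y≤z above′ S′) p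
  with refl ← ≤-antisym (head-maximal p x≤z above′) (head-maximal (↭-sym p) y≤z above) =
  cong (x ∷_) (Step-unique S S′ (↭P.drop-∷ p))

head-least : ∀ {u v us vs} → v ∷ vs ↭ u ∷ us → All (u <_) us → u ≤ v
head-least q u<us with ↭P.∈-resp-↭ q (here refl)
... | here refl = ≤-refl
... | there v∈  = <⇒≤ (All.lookup u<us v∈)

increasing-unique : ∀ {xs ys} → AllPairs _<_ xs → AllPairs _<_ ys → xs ↭ ys → xs ≡ ys
increasing-unique []       []       _ = refl
increasing-unique []       (_ ∷ _)  p with () ← ↭P.↭-length p
increasing-unique (_ ∷ _)  []       p with () ← ↭P.↭-length p
increasing-unique {x ∷ xs} {y ∷ ys} (x< ∷ inc) (y< ∷ inc′) p
  with refl ← ≤-antisym (head-least (↭-sym p) x<) (head-least p y<) =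
  cong (x ∷_) (increasing-unique inc inc′ (↭P.drop-∷ p))

Unique-resp-↭ : ∀ {xs ys : List ℕ} → xs ↭ ys → Unique xs → Unique ys
Unique-resp-↭ p = ↭SetoidP.Unique-resp-↭ (setoid ℕ) (↭⇒↭ₛ p)

largest-≤ : ∀ z ds → All (z <_) ds ⊎
  (∃ λ x → ∃ λ rest → ds ↭ x ∷ rest × x ≤ z × All (λ y → y ≤ z → y ≤ x) rest)
largest-≤ z [] = inj₁ []
largest-≤ z (d ∷ ds) with d ≤? z | largest-≤ z ds
... | no  d≰z | inj₁ above = inj₁ (≰⇒> d≰z ∷ above)
... | yes d≤z | inj₁ above =
  inj₂ (d , ds , ↭-refl , d≤z , All.map (λ z<y y≤z → contradiction z<y (≤⇒≯ y≤z)) above)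
... | no  d≰z | inj₂ (x , rest , p , x≤z , max) =
  inj₂ (x , d ∷ rest , ↭-trans (prep d p) (swap d x ↭-refl) , x≤z , (λ d≤z → contradiction d≤z d≰z) ∷ max)
... | yes d≤z | inj₂ (x , rest , p , x≤z , max) with ≤-total d x
...   | inj₁ d≤x = inj₂ (x , d ∷ rest , ↭-trans (prep d p) (swap d x ↭-refl) , x≤z , (λ _ → d≤x) ∷ max)
...   | inj₂ x≤d = inj₂ (d , x ∷ rest , prep d p , d≤z ,
                         (λ _ → x≤d) ∷ All.map (λ y≤x y≤z → ≤-trans (y≤x y≤z) x≤d) max)

-- For t > z neither count changes, and for t ≤ x both drop by 1. For x < t ≤ z, maximality of x
-- leaves no entry of `rest` between t and z, so t may be replaced by z + 1.
hall-tail : ∀ {z x} zs rest → x ≤ z → All (λ y → y ≤ z → y ≤ x) rest →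
  (∀ t → atLeast t (x ∷ rest) ≤ atLeast t (z ∷ zs)) → ∀ t → atLeast t rest ≤ atLeast t zs
hall-tail {z} {x} zs rest x≤z max hall = bound
  where
  hall-above : ∀ t → z < t → atLeast t rest ≤ atLeast t zs
  hall-above t z<t = subst₂ _≤_
    (cong (_+ atLeast t rest) (𝟙-no (t ≤? x) (<⇒≱ (≤-<-trans x≤z z<t))))
    (cong (_+ atLeast t zs) (𝟙-no (t ≤? z) (<⇒≱ z<t))) (hall t)
  bound : ∀ t → atLeast t rest ≤ atLeast t zs
  bound t with t ≤? x | t ≤? z
  ... | _       | no t≰z  = hall-above t (≰⇒> t≰z)
  ... | yes t≤x | yes t≤z = +-cancelˡ-≤ 1 _ _ (subst₂ _≤_
    (cong (_+ atLeast t rest) (𝟙-yes (t ≤? x) t≤x))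
    (cong (_+ atLeast t zs) (𝟙-yes (t ≤? z) t≤z)) (hall t))
  ... | no t≰x  | yes t≤z = begin
    atLeast t rest        ≤⟨ tally-mono rest (All.map (λ {y} y≤x → 𝟙-mono (t ≤? y) (suc z ≤? y)
                               (λ t≤y → ≰⇒> (λ y≤z → t≰x (≤-trans t≤y (y≤x y≤z))))) max) ⟩
    atLeast (suc z) rest  ≤⟨ hall-above (suc z) ≤-refl ⟩
    atLeast (suc z) zs    ≤⟨ tally-mono zs (All.universal (λ y → 𝟙-mono (suc z ≤? y) (t ≤? y)
                               (≤-trans (m≤n⇒m≤1+n t≤z))) zs) ⟩
    atLeast t zs          ∎
    where open ≤-Reasoning

-- The hypothesis on `atLeast` is Hall's condition for matching each entry to a left neighbour at
-- least as large. If no entry were ≤ z, all of `ds` would exceed z, but at most the entries of `zs`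
-- do.
greedy : ∀ zs ds → length ds ≡ length zs → Unique ds → (∀ t → atLeast t ds ≤ atLeast t zs) →
         ∃ λ xs → xs ↭ ds × Step zs xs
greedy [] [] _ _ _ = [] , ↭-refl , []
greedy (z ∷ zs) ds len uds hall with largest-≤ z ds
... | inj₁ above = contradiction (begin-strict
    length zs                 <⟨ ≤-reflexive (sym len) ⟩
    length ds                 ≡⟨ atLeast-All (suc z) above ⟨
    atLeast (suc z) ds        ≤⟨ hall (suc z) ⟩
    atLeast (suc z) (z ∷ zs)  ≡⟨ cong (_+ atLeast (suc z) zs) (𝟙-no (suc z ≤? z) (<-irrefl refl)) ⟩
    atLeast (suc z) zs        ≤⟨ atLeast-≤-length (suc z) zs ⟩
    length zs                 ∎) (<-irrefl refl)
  where open ≤-Reasoning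
... | inj₂ (x , rest , p , x≤z , max)
  with x∉ ∷ urest ← Unique-resp-↭ p uds
  with xs , q , S ← greedy zs rest (suc-injective (trans (sym (↭P.↭-length p)) len)) urest
    (hall-tail zs rest x≤z max (λ t → subst (_≤ atLeast t (z ∷ zs)) (tally-↭ (λ y → 𝟙 (t ≤? y)) p) (hall t)))
  = x ∷ xs , ↭-trans (prep x q) (↭-sym p) ,
    cons x≤z (↭P.All-resp-↭ (↭-sym q) (All.zipWith (λ (x≢y , y≤x) y≤z → ≤∧≢⇒< (y≤x y≤z) (x≢y ∘ sym)) (x∉ , max))) S

column : ℕ → (ℕ → ℕ → ℕ) → ℕ → List ℕ
column ℓ g k = applyUpTo (λ r → g r k) ℓ

coColumn : ℕ → ℕ → (ℕ → ℕ → ℕ) → ℕ → List ℕ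
coColumn n ℓ g k = applyUpTo (λ r → suc n ∸ g r k) ℓ

Rectangle : ℕ → ℕ → ℕ → (ℕ → ℕ → ℕ) → Set
Rectangle ℓ m = Filling ℓ (λ _ → suc m)

-- The columns of g′ are, as sets, the complements of those of g in reverse order.
Evacuation : ℕ → ℕ → ℕ → (ℕ → ℕ → ℕ) → (ℕ → ℕ → ℕ) → Set
Evacuation n ℓ m g g′ = ∀ k → k ≤ m → column ℓ g′ k ↭ coColumn n ℓ g (m ∸ k)

AllPairs-applyUpTo⁻ : ∀ {R : ℕ → ℕ → Set} {xs} → AllPairs R xs → ∀ {i j} → i < j → j < length xs → R (at xs i) (at xs j)
AllPairs-applyUpTo⁻ (Rx ∷ _)  {zero}  {suc j} _   j<l = at-All Rx (s≤s⁻¹ j<l)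
AllPairs-applyUpTo⁻ (_ ∷ Rxs) {suc i} {suc j} i<j j<l = AllPairs-applyUpTo⁻ Rxs (s≤s⁻¹ i<j) (s≤s⁻¹ j<l)

module _ {ℓ m n g} (F : Rectangle ℓ m n g) where
  open Filling F
  open FillingProperties F

  column-increasing : AllPairs _<_ (column ℓ g 0)
  column-increasing = AllPairsP.applyUpTo⁺₁ (λ r → g r 0) ℓ (λ i<j j<ℓ → col-strict i<j j<ℓ)

  column-Step : ∀ k → k < m → Step (column ℓ g k) (column ℓ g (suc k))
  column-Step k k<m = Step-applyUpTo ℓ _ _ (λ i<ℓ → row-step i<ℓ (s<s k<m))
    (λ i<j j<ℓ → typeA i<j j<ℓ ≤-refl (s<s k<m))

  coColumn-range : ∀ k → k ≤ m → All (λ x → 0 < x × x ≤ n) (coColumn n ℓ g k)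
  coColumn-range k k≤m = AllP.applyUpTo⁺₁ _ ℓ λ {i} i<ℓ →
    m<n⇒0<n∸m (s≤s (bounded i<ℓ (s≤s k≤m))) , ∸-monoʳ-≤ (suc n) (positive i<ℓ (s≤s k≤m))

  coColumn-Unique : ∀ k → k ≤ m → Unique (coColumn n ℓ g k)
  coColumn-Unique k k≤m = UniqueP.applyUpTo⁺₁ _ ℓ λ {i} {j} i<j j<ℓ eq →
    column-distinct-< k i<j j<ℓ (s≤s k≤m) (s≤s k≤m)
      (∸-cancelˡ-≡ (m≤n⇒m≤1+n (bounded (<-trans i<j j<ℓ) (s≤s k≤m))) (m≤n⇒m≤1+n (bounded j<ℓ (s≤s k≤m))) eq)

  -- Rows weakly decrease, so complements weakly increase along rows; read in reverse order,
  -- adjacent columns satisfy the condition of `greedy`.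
  coColumn-hall : ∀ k t → atLeast t (coColumn n ℓ g (m ∸ suc k)) ≤ atLeast t (coColumn n ℓ g (m ∸ k))
  coColumn-hall k t = subst₂ _≤_ (sym (tally-applyUpTo _ ℓ _)) (sym (tally-applyUpTo _ ℓ _))
    (∑-mono-≤ ℓ (λ r r<ℓ → 𝟙-mono (t ≤? suc n ∸ g r (m ∸ suc k)) (t ≤? suc n ∸ g r (m ∸ k))
      (λ t≤ → ≤-trans t≤ (∸-monoʳ-≤ (suc n) (left r<ℓ)))))
    where
    left : ∀ {r} → r < ℓ → g r (m ∸ k) ≤ g r (m ∸ suc k)
    left {r} r<ℓ rewrite sym (pred[m∸n]≡m∸[1+n] m k) with m ∸ k | m∸n≤m m k
    ... | zero  | _   = ≤-refl
    ... | suc j | j<m = row-step r<ℓ (s<s j<m)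

  private
    -- The sorted complement of column m comes first, and each further column is matched to the
    -- preceding one. Beyond index m, truncated subtraction repeats the complement of column 0,
    -- which keeps the recursion total.
    newColumn : ∀ k → ∃ λ c → c ↭ coColumn n ℓ g (m ∸ k)
    newStep : ∀ k → ∃ λ c → c ↭ coColumn n ℓ g (m ∸ suc k) × Step (proj₁ (newColumn k)) c

    newColumn zero    = sort (coColumn n ℓ g m) , sort-↭ _
    newColumn (suc k) = proj₁ (newStep k) , proj₁ (proj₂ (newStep k))

    newStep k = greedy (proj₁ (newColumn k)) (coColumn n ℓ g (m ∸ suc k))
      (trans (length-applyUpTo _ ℓ) (sym (trans (↭P.↭-length (proj₂ (newColumn k))) (length-applyUpTo _ ℓ))))
      (coColumn-Unique (m ∸ suc k) (m∸n≤m m (suc k)))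
      (λ t → ≤-trans (coColumn-hall k t) (≤-reflexive (tally-↭ _ (↭-sym (proj₂ (newColumn k))))))

    g′ : ℕ → ℕ → ℕ
    g′ r k = at (proj₁ (newColumn k)) r

    length-newColumn : ∀ k → length (proj₁ (newColumn k)) ≡ ℓ
    length-newColumn k = trans (↭P.↭-length (proj₂ (newColumn k))) (length-applyUpTo _ ℓ)

    inside : ∀ k {r} → r < ℓ → r < length (proj₁ (newColumn k))
    inside k = subst (_ <_) (sym (length-newColumn k))

    range : ∀ k {r} → r < ℓ → 0 < g′ r k × g′ r k ≤ n
    range k r<ℓ = at-All (↭P.All-resp-↭ (↭-sym (proj₂ (newColumn k))) (coColumn-range (m ∸ k) (m∸n≤m m k))) (inside k r<ℓ)

    first-increasing : AllPairs _<_ (proj₁ (newColumn 0))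
    first-increasing = AllPairs.zipWith (λ (x≤y , x≢y) → ≤∧≢⇒< x≤y x≢y)
      (Linked⇒AllPairs ≤-trans (sort-↗ _) , Unique-resp-↭ (↭-sym (sort-↭ _)) (coColumn-Unique m ≤-refl))

  evacuate : ∃ λ g′ → Rectangle ℓ m n g′ × Evacuation n ℓ m g g′
  evacuate = g′ , record
    { positive = λ {_} {k} r<ℓ _ → proj₁ (range k r<ℓ)
    ; bounded  = λ {_} {k} r<ℓ _ → proj₂ (range k r<ℓ)
    ; row-step = λ {r} {k} r<ℓ _ → Step-≤ (proj₂ (proj₂ (newStep k))) (inside (suc k) r<ℓ)
    ; col-step = λ {r} sr<ℓ → AllPairs-applyUpTo⁻ first-increasing (n<1+n r) (inside 0 sr<ℓ)
    ; typeA    = λ {_} {_} {k} i<i′ i′<ℓ _ _ → Step-typeA (proj₂ (proj₂ (newStep k))) i<i′ (inside (suc k) i′<ℓ)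
    ; typeB    = λ _ _ sm<sm → contradiction sm<sm (<-irrefl refl)
    } , λ k _ → ↭-trans (↭-reflexive (trans (cong (applyUpTo (λ r → g′ r k)) (sym (length-newColumn k)))
                                            (applyUpTo-at (proj₁ (newColumn k))))) (proj₂ (newColumn k))

rectangle-determined : ∀ {ℓ m n g h} → Rectangle ℓ m n g → Rectangle ℓ m n h →
  (∀ k → k ≤ m → column ℓ g k ↭ column ℓ h k) → ∀ k → k ≤ m → column ℓ g k ≡ column ℓ h k
rectangle-determined F G same zero    _    = increasing-unique (column-increasing F) (column-increasing G) (same 0 z≤n)
rectangle-determined {ℓ} {h = h} F G same (suc k) sk≤m = Step-unique (column-Step F k sk≤m)
  (subst (λ c → Step c (column ℓ h (suc k))) (sym (rectangle-determined F G same k (<⇒≤ sk≤m))) (column-Step G k sk≤m))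
  (same (suc k) sk≤m)

-- Complementing twice recovers the columns of the sources as sets, and these determine a
-- rectangular filling.
evacuation-injective : ∀ {ℓ m n g h g′ h′} → Rectangle ℓ m n g → Rectangle ℓ m n h →
  Evacuation n ℓ m g g′ → Evacuation n ℓ m h h′ →
  Agree ℓ (λ _ → suc m) g′ h′ → Agree ℓ (λ _ → suc m) g h
evacuation-injective {ℓ} {m} {n} {g} {h} {g′} {h′} F G E E′ agree {r} {k} r<ℓ k<sm =
  trans (sym (at-applyUpTo ℓ (λ r → g r k) r<ℓ))
    (trans (cong (λ c → at c r) (rectangle-determined F G same k (s≤s⁻¹ k<sm))) (at-applyUpTo ℓ (λ r → h r k) r<ℓ))
  where
  co : ∀ k → k ≤ m → coColumn n ℓ g k ↭ coColumn n ℓ h k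
  co k k≤m = subst₂ (λ i j → coColumn n ℓ g i ↭ coColumn n ℓ h j) (m∸[m∸n]≡n k≤m) (m∸[m∸n]≡n k≤m)
    (↭-trans (↭-sym (E (m ∸ k) (m∸n≤m m k))) (↭-trans
      (↭-reflexive (applyUpTo-cong ℓ (λ i i<ℓ → agree i<ℓ (s≤s (m∸n≤m m k))))) (E′ (m ∸ k) (m∸n≤m m k))))
  complement² : ∀ {f} → Rectangle ℓ m n f → ∀ k → k ≤ m → map (suc n ∸_) (coColumn n ℓ f k) ≡ column ℓ f k
  complement² {f} H k k≤m = trans (map-applyUpTo (λ r → suc n ∸ f r k) (suc n ∸_) ℓ)
    (applyUpTo-cong ℓ (λ i i<ℓ → m∸[m∸n]≡n (m≤n⇒m≤1+n (Filling.bounded H i<ℓ (s≤s k≤m)))))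
  same : ∀ k → k ≤ m → column ℓ g k ↭ column ℓ h k
  same k k≤m = subst₂ _↭_ (complement² F k k≤m) (complement² G k k≤m) (↭P.map⁺ (suc n ∸_) (co k k≤m))

∑-evacuation : ∀ {n ℓ m g g′} → Evacuation n ℓ m g g′ → ∀ φ {k} → k ≤ m →
  ∑ ℓ (λ r → φ (g′ r k)) ≡ ∑ ℓ (λ r → φ (suc n ∸ g r (m ∸ k)))
∑-evacuation {ℓ = ℓ} E φ {k} k≤m =
  trans (sym (tally-applyUpTo φ ℓ _)) (trans (tally-↭ φ (E k k≤m)) (tally-applyUpTo φ ℓ _))

≡-complement : ∀ {n v x} → v < n → x ≤ n → suc v ≡ suc n ∸ x → n ∸ v ≡ x
≡-complement {n} {v} {x} v<n x≤n eq = trans (cong (suc n ∸_) eq) (m∸[m∸n]≡n (m≤n⇒m≤1+n x≤n))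

complement-≡ : ∀ {n v x} → v < n → n ∸ v ≡ x → suc v ≡ suc n ∸ x
complement-≡ {n} {v} v<n refl = sym (m∸[m∸n]≡n {suc n} {suc v} (m≤n⇒m≤1+n v<n))

evacuation-occurrences : ∀ {ℓ m n g g′} → Rectangle ℓ m n g → Evacuation n ℓ m g g′ → ∀ v → v < n →
  occurrences ℓ (λ _ → suc m) g′ (suc v) ≡ occurrences ℓ (λ _ → suc m) g (n ∸ v)
evacuation-occurrences {ℓ} {m} {n} {g} {g′} F E v v<n = begin
  ∑ ℓ (λ r → ∑ (suc m) (λ k → 𝟙 (suc v ≟ g′ r k)))   ≡⟨ ∑-comm ℓ (suc m) (λ r k → 𝟙 (suc v ≟ g′ r k)) ⟩
  ∑ (suc m) (λ k → ∑ ℓ (λ r → 𝟙 (suc v ≟ g′ r k)))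
    ≡⟨ ∑-reverse (suc m) (λ i j eq → trans (∑-evacuation {g = g} {g′} E (λ x → 𝟙 (suc v ≟ x)) (m+n≤o⇒m≤o i (≤-reflexive (suc-injective eq))))
         (∑-cong ℓ (λ r r<ℓ → trans
           (cong (λ k → 𝟙 (suc v ≟ suc n ∸ g r k)) (trans (cong (_∸ i) (sym (suc-injective eq))) (m+n∸m≡n i j)))
           (𝟙-cong (suc v ≟ suc n ∸ g r j) (n ∸ v ≟ g r j)
             (≡-complement v<n (Filling.bounded F r<ℓ (suc-sum-< j i (suc-sum-comm i j eq)))) (complement-≡ v<n))))) ⟩
  ∑ (suc m) (λ k → ∑ ℓ (λ r → 𝟙 (n ∸ v ≟ g r k)))    ≡⟨ ∑-comm ℓ (suc m) (λ r k → 𝟙 (n ∸ v ≟ g r k)) ⟨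
  ∑ ℓ (λ r → ∑ (suc m) (λ k → 𝟙 (n ∸ v ≟ g r k)))    ∎
  where open ≡-Reasoning

rectangle-injection : ∀ n ℓ m → ComplementingInjection n ℓ (λ _ → suc m) (λ _ → suc m)
rectangle-injection n ℓ m = record
  { Related   = Evacuation n ℓ m
  ; image     = λ F → let g′ , F′ , E = evacuate F in g′ , F′ , evacuation-occurrences F E , E
  ; injective = evacuation-injective
  }

-- Parts 1 and 2

double : (ℕ → ℕ) → (ℕ → ℕ → ℕ) → ℕ → ℕ → ℕ
double a g r k = if does (a r ≟ 1) then g r 0 else g r k

double-1 : ∀ {a} g {r} k → a r ≡ 1 → double a g r k ≡ g r 0
double-1 g k eq rewrite eq = refl

double-2 : ∀ {a} g {r} k → a r ≡ 2 → double a g r k ≡ g r k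
double-2 g k eq rewrite eq = refl

double-0 : ∀ a g r → double a g r 0 ≡ g r 0
double-0 a g r with does (a r ≟ 1)
... | true  = refl
... | false = refl

one-or-two : ∀ {m} → OneOrTwo m → m ≡ 1 ⊎ m ≡ 2
one-or-two is1 = inj₁ refl
one-or-two is2 = inj₂ refl

OneOrTwo-positive : ∀ {m} → OneOrTwo m → 0 < m
OneOrTwo-positive is1 = z<s
OneOrTwo-positive is2 = z<s

OneOrTwo-≤2 : ∀ {m} → OneOrTwo m → m ≤ 2
OneOrTwo-≤2 is1 = s≤s z≤n
OneOrTwo-≤2 is2 = ≤-refl

DoubledRows : ℕ → (ℕ → ℕ) → (ℕ → ℕ → ℕ) → Set
DoubledRows ℓ a h = ∀ {r} → r < ℓ → a r ≡ 1 → h r 1 ≡ h r 0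

module _ {ℓ : ℕ} {a : ℕ → ℕ} (a∈12 : ∀ {r} → r < ℓ → OneOrTwo (a r)) where

  Agree-double : ∀ g → Agree ℓ a (double a g) g
  Agree-double g {r} {k} r<ℓ k<a with one-or-two (a∈12 r<ℓ)
  ... | inj₂ a≡2 = double-2 {a} g k a≡2
  ... | inj₁ a≡1 rewrite a≡1 with s≤s z≤n ← k<a = refl

  DoubledRows-double : ∀ g → DoubledRows ℓ a (double a g)
  DoubledRows-double g {r} _ a≡1 = trans (double-1 {a} g 1 a≡1) (sym (double-1 {a} g 0 a≡1))

  DoubledRows-Agree : ∀ {g h} → DoubledRows ℓ a g → DoubledRows ℓ a h → Agree ℓ a g h → Agree ℓ (λ _ → 2) g h
  DoubledRows-Agree dg dh agree {r} {k} r<ℓ k<2 with one-or-two (a∈12 r<ℓ) | k | k<2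
  ... | inj₂ a≡2 | k    | k<2 = agree r<ℓ (subst (k <_) (sym a≡2) k<2)
  ... | inj₁ a≡1 | zero | _   = agree r<ℓ (subst (0 <_) (sym a≡1) z<s)
  ... | inj₁ a≡1 | suc zero | _ =
    trans (dg r<ℓ a≡1) (trans (agree r<ℓ (subst (0 <_) (sym a≡1) z<s)) (sym (dh r<ℓ a≡1)))
  ... | inj₁ _   | suc (suc k) | s≤s (s≤s ())

  -- The correction term counts the heads of the rows of length 1; it is cancelled when contents of
  -- shapes with parts 1 and 2 are compared.
  doubled-occurrences : ∀ {h} → DoubledRows ℓ a h → ∀ v →
    occurrences ℓ (λ _ → 2) h v ≡ occurrences ℓ a h v + ∑ ℓ (λ r → 𝟙 (a r ≟ 1) * 𝟙 (v ≟ h r 0))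
  doubled-occurrences {h} dh v = trans (∑-cong ℓ per-row) (∑-+ ℓ (λ r → ∑ (a r) (λ k → 𝟙 (v ≟ h r k))) _)
    where
    per-row : ∀ r → r < ℓ → ∑ 2 (λ k → 𝟙 (v ≟ h r k)) ≡
          ∑ (a r) (λ k → 𝟙 (v ≟ h r k)) + 𝟙 (a r ≟ 1) * 𝟙 (v ≟ h r 0)
    per-row r r<ℓ with one-or-two (a∈12 r<ℓ)
    ... | inj₂ a≡2 rewrite a≡2 = sym (+-identityʳ _)
    ... | inj₁ a≡1 rewrite dh r<ℓ a≡1 | a≡1 | +-identityʳ (𝟙 (v ≟ h r 0)) = refl

  module _ {n g} (F : Filling ℓ a n g) where
    open Filling F
    open FillingProperties F

    private
      a-pos : ∀ {r} → r < ℓ → 0 < a r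
      a-pos r<ℓ = OneOrTwo-positive (a∈12 r<ℓ)

      d : ℕ → ℕ → ℕ
      d = double a g

    -- For a doubled row above this is the increase of the first column, for a row of length 2 it is
    -- type B. It is the trace that type B leaves in the rectangle, and `undouble` needs it back.
    above-doubled : ∀ {r s} → a r ≡ 1 → r < s → s < ℓ → d r 0 < d s 1
    above-doubled {r} {s} ar≡1 r<s s<ℓ with one-or-two (a∈12 s<ℓ)
    ... | inj₁ as≡1 = subst₂ _<_ (sym (double-0 a g r)) (sym (double-1 {a} g 1 as≡1)) (col-strict r<s s<ℓ)
    ... | inj₂ as≡2 = subst₂ _<_ (sym (double-0 a g r)) (sym (double-2 {a} g 1 as≡2))
          (longer-above-next r<s s<ℓ (subst₂ _<_ (sym ar≡1) (sym as≡2) ≤-refl) (a-pos (<-trans r<s s<ℓ))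
            (subst (1 <_) (sym as≡2) ≤-refl))

    double-row : ∀ {r} → r < ℓ → d r 1 ≤ d r 0
    double-row {r} r<ℓ with one-or-two (a∈12 r<ℓ)
    ... | inj₁ a≡1 = ≤-reflexive (DoubledRows-double g r<ℓ a≡1)
    ... | inj₂ a≡2 = subst₂ _≤_ (sym (double-2 {a} g 1 a≡2)) (sym (double-0 a g r))
                       (row-step r<ℓ (subst (1 <_) (sym a≡2) ≤-refl))

    -- Only type A needs an argument. If either row is doubled, y > z and the condition is vacuous;
    -- if both have length 2, it is the original one.
    double-filling : Rectangle ℓ 1 n d
    double-filling = record
      { positive = λ {r} {k} r<ℓ k<2 → proj₁ (range r k r<ℓ k<2)
      ; bounded  = λ {r} {k} r<ℓ k<2 → proj₂ (range r k r<ℓ k<2)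
      ; row-step = λ { {r} {zero} r<ℓ _ → double-row r<ℓ ; {r} {suc k} _ (s≤s (s≤s ())) }
      ; col-step = λ {r} sr<ℓ → subst₂ _<_ (sym (double-0 a g r)) (sym (double-0 a g (suc r))) (col-step sr<ℓ)
      ; typeA    = λ { {i} {i′} {zero} i<i′ i′<ℓ _ _ → tA i<i′ i′<ℓ ; {k = suc k} _ _ _ (s≤s (s≤s ())) }
      ; typeB    = λ _ _ 2<2 → contradiction 2<2 (<-irrefl refl)
      }
      where
      range : ∀ r k → r < ℓ → k < 2 → 0 < d r k × d r k ≤ n
      range r k r<ℓ k<2 with one-or-two (a∈12 r<ℓ)
      ... | inj₁ a≡1 rewrite double-1 {a} g {r} k a≡1 = positive r<ℓ (a-pos r<ℓ) , bounded r<ℓ (a-pos r<ℓ)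
      ... | inj₂ a≡2 rewrite double-2 {a} g {r} k a≡2 =
        let k<a = subst (k <_) (sym a≡2) k<2 in positive r<ℓ k<a , bounded r<ℓ k<a
      tA : ∀ {i i′} → i < i′ → i′ < ℓ → d i′ 1 ≤ d i 0 → d i′ 1 < d i 1
      tA {i} {i′} i<i′ i′<ℓ y≤z with one-or-two (a∈12 (<-trans i<i′ i′<ℓ)) | one-or-two (a∈12 i′<ℓ)
      ... | inj₁ ai≡1 | _ = contradiction (above-doubled ai≡1 i<i′ i′<ℓ) (≤⇒≯ y≤z)
      ... | inj₂ _ | inj₁ ai′≡1 = contradiction (col-strict i<i′ i′<ℓ)
            (≤⇒≯ (subst₂ _≤_ (double-1 {a} g 1 ai′≡1) (double-0 a g i) y≤z))
      ... | inj₂ ai≡2 | inj₂ ai′≡2 = subst₂ _<_ (sym (double-2 {a} g 1 ai′≡2)) (sym (double-2 {a} g 1 ai≡2))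
            (typeA i<i′ i′<ℓ (≤-reflexive (trans ai′≡2 (sym ai≡2))) (subst (1 <_) (sym ai′≡2) ≤-refl)
              (subst₂ _≤_ (double-2 {a} g 1 ai′≡2) (double-0 a g i) y≤z))

  -- With parts 1 and 2, type B triples come only from a row of length 1 below a row of length 2, in
  -- the first column, which is what the hypothesis covers.
  undouble : ∀ {n h} → Rectangle ℓ 1 n h →
    (∀ {r s} → a r ≡ 1 → r < s → s < ℓ → h r 0 < h s 1) → Filling ℓ a n h
  undouble {n} {h} H above = record
    { positive = λ r<ℓ k<a → positive r<ℓ (<-≤-trans k<a (a≤2 r<ℓ))
    ; bounded  = λ r<ℓ k<a → bounded r<ℓ (<-≤-trans k<a (a≤2 r<ℓ))
    ; row-step = λ r<ℓ sk<a → row-step r<ℓ (<-≤-trans sk<a (a≤2 r<ℓ))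
    ; col-step = col-step
    ; typeA    = λ i<i′ i′<ℓ _ sk<a → typeA i<i′ i′<ℓ ≤-refl (<-≤-trans sk<a (a≤2 i′<ℓ))
    ; typeB    = λ {i} {i′} {k} i<i′ i′<ℓ ai<ai′ k<ai sk<ai′ _ → tB i<i′ i′<ℓ ai<ai′ k<ai
    }
    where
    open Filling H
    a≤2 : ∀ {r} → r < ℓ → a r ≤ 2
    a≤2 r<ℓ = OneOrTwo-≤2 (a∈12 r<ℓ)
    tB : ∀ {i i′ k} → i < i′ → i′ < ℓ → a i < a i′ → k < a i → h i k < h i′ (suc k)
    tB {i} i<i′ i′<ℓ ai<ai′ k<ai with one-or-two (a∈12 (<-trans i<i′ i′<ℓ))
    ... | inj₂ ai≡2 = contradiction (<-≤-trans ai<ai′ (a≤2 i′<ℓ)) (<-irrefl ai≡2)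
    ... | inj₁ ai≡1 with s≤s z≤n ← subst (_ <_) ai≡1 k<ai = above ai≡1 i<i′ i′<ℓ

∑-initial-< : ∀ {n r} → r < n → ∑ n (λ i → 𝟙 (i <? r)) < ∑ n (λ i → 𝟙 (i ≤? r))
∑-initial-< {n} {r} r<n = ∑-mono-< n r r<n
  (subst₂ _<_ (sym (𝟙-no (r <? r) (<-irrefl refl))) (sym (𝟙-yes (r ≤? r) ≤-refl)) ≤-refl)
  (λ i _ → 𝟙-mono (i <? r) (i ≤? r) <⇒≤)

-- The entries of f above row s are > u and those below it are < u, so exactly r entries of each
-- column of h are < w, and they fill the rows below r.
module _ {n ℓ f h r s} (F : Rectangle ℓ 1 n f) (H : Rectangle ℓ 1 n h) (E : Evacuation n ℓ 1 f h)
  (index : suc (r + s) ≡ ℓ) (constant : f s 1 ≡ f s 0) (above : ∀ {i} → s < i → i < ℓ → f s 0 < f i 1) where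
  private
    module F = Filling F
    module H = Filling H
    module FP = FillingProperties F
    module HP = FillingProperties H

    u w : ℕ
    u = f s 0
    w = suc n ∸ u

    r<ℓ : r < ℓ
    r<ℓ = suc-sum-< r s index
    s<ℓ : s < ℓ
    s<ℓ = suc-sum-< s r (suc-sum-comm r s index)
    u≤n : u ≤ n
    u≤n = F.bounded s<ℓ z<s

    opposite-< : ∀ i j → suc (i + j) ≡ ℓ → s < j → i < r
    opposite-< i j eq s<j = +-cancelʳ-≤ s (suc i) r
      (≤-trans (≤-reflexive (sym (+-suc i s)))
               (≤-trans (+-monoʳ-≤ i s<j) (≤-reflexive (suc-injective (trans eq (sym index))))))

    opposite-<′ : ∀ i j → suc (i + j) ≡ ℓ → i < r → s < j
    opposite-<′ i j eq i<r = +-cancelˡ-≤ i (suc s) j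
      (≤-trans (≤-reflexive (+-suc i s))
               (≤-trans (+-monoˡ-≤ s i<r) (≤-reflexive (suc-injective (trans index (sym eq))))))

    above-iff : ∀ k → k < 2 → ∀ j → j < ℓ → (u < f j k → s < j) × (s < j → u < f j k)
    above-iff k k<2 j j<ℓ = to , from k k<2
      where
      to : u < f j k → s < j
      to u<f = ≰⇒> λ j≤s → <-irrefl refl (<-≤-trans u<f (≤-trans (FP.row-head k j<ℓ k<2) (FP.col-mono j≤s s<ℓ)))
      from : ∀ k → k < 2 → s < j → u < f j k
      from zero          _ s<j = FP.col-strict s<j j<ℓ
      from (suc zero)    _ s<j = above s<j j<ℓ
      from (suc (suc _)) (s≤s (s≤s ()))

    count-< : ∀ k → k ≤ 1 → ∑ ℓ (λ i → 𝟙 (h i k <? w)) ≡ ∑ ℓ (λ i → 𝟙 (i <? r))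
    count-< k k≤1 = trans (∑-evacuation {g = f} {h} E (λ x → 𝟙 (x <? w)) k≤1)
      (sym (∑-reverse ℓ (λ i j eq → 𝟙-cong (i <? r) (suc n ∸ f j (1 ∸ k) <? w)
        (λ i<r → ∸-monoʳ-< (proj₂ (iff i j eq) (opposite-<′ i j eq i<r))
                   (m≤n⇒m≤1+n (F.bounded (suc-sum-< j i (suc-sum-comm i j eq)) 1∸k<2)))
        (λ lt → opposite-< i j eq (proj₁ (iff i j eq) (∸-cancelʳ-< {o = suc n} lt))))))
      where
      1∸k<2 : 1 ∸ k < 2
      1∸k<2 = s≤s (m∸n≤m 1 k)
      iff : ∀ i j → suc (i + j) ≡ ℓ → (u < f j (1 ∸ k) → s < j) × (s < j → u < f j (1 ∸ k))
      iff i j eq = above-iff (1 ∸ k) 1∸k<2 j (suc-sum-< j i (suc-sum-comm i j eq))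

    -- Column 0 of `h` comes from column 1 of `f`, where by `constant` row s contributes another
    -- `u`. So, besides the r smaller heads, exactly one head of `h` equals `w`.
    count-≤w : ∑ ℓ (λ i → 𝟙 (h i 0 ≤? w)) ≡ ∑ ℓ (λ i → 𝟙 (i ≤? r))
    count-≤w = trans (∑-evacuation {g = f} {h} E (λ x → 𝟙 (x ≤? w)) z≤n)
      (sym (∑-reverse ℓ (λ i j eq → 𝟙-cong (i ≤? r) (suc n ∸ f j 1 ≤? w)
        (λ i≤r → ∸-monoʳ-≤ (suc n) (from i j eq (m≤n⇒m<n∨m≡n i≤r)))
        (λ le → ≮⇒≥ (λ r<i → <⇒≱ (∸-monoʳ-< (below i j eq r<i) (m≤n⇒m≤1+n u≤n)) le)))))
      where
      from : ∀ i j → suc (i + j) ≡ ℓ → i < r ⊎ i ≡ r → u ≤ f j 1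
      from i j eq (inj₁ i<r) = <⇒≤ (above (opposite-<′ i j eq i<r) (suc-sum-< j i (suc-sum-comm i j eq)))
      from i j eq (inj₂ refl) with refl ← +-cancelˡ-≡ i s j (suc-injective (trans index (sym eq))) =
        ≤-reflexive (sym constant)
      below : ∀ i j → suc (i + j) ≡ ℓ → r < i → f j 1 < u
      below i j eq r<i = ≤-<-trans (F.row-step (suc-sum-< j i (suc-sum-comm i j eq)) ≤-refl)
        (FP.col-strict (+-cancelˡ-≤ r (suc j) s (≤-trans (≤-reflexive (+-suc r j))
          (≤-trans (+-monoˡ-≤ j r<i) (≤-reflexive (suc-injective (trans eq (sym index))))))) s<ℓ)

    head-≥ : w ≤ h r 0
    head-≥ = ≮⇒≥ λ hr<w → <-irrefl refl (begin-strict
      ∑ ℓ (λ i → 𝟙 (i <? r))        <⟨ ∑-initial-< r<ℓ ⟩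
      ∑ ℓ (λ i → 𝟙 (i ≤? r))        ≤⟨ ∑-mono-≤ ℓ (λ i _ → 𝟙-mono (i ≤? r) (h i 0 <? w)
                                         (λ i≤r → ≤-<-trans (HP.col-mono i≤r r<ℓ) hr<w)) ⟩
      ∑ ℓ (λ i → 𝟙 (h i 0 <? w))    ≡⟨ count-< 0 z≤n ⟩
      ∑ ℓ (λ i → 𝟙 (i <? r))        ∎)
      where open ≤-Reasoning

    head-≤ : h r 0 ≤ w
    head-≤ = ≮⇒≥ λ w<hr → <-irrefl refl (begin-strict
      ∑ ℓ (λ i → 𝟙 (i <? r))        <⟨ ∑-initial-< r<ℓ ⟩
      ∑ ℓ (λ i → 𝟙 (i ≤? r))        ≡⟨ count-≤w ⟨
      ∑ ℓ (λ i → 𝟙 (h i 0 ≤? w))    ≤⟨ ∑-mono-≤ ℓ (λ i i<ℓ → 𝟙-mono (h i 0 ≤? w) (i <? r)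
                                         (λ hi≤w → ≰⇒> (λ r≤i → <-irrefl refl
                                           (≤-<-trans (≤-trans (HP.col-mono r≤i i<ℓ) hi≤w) w<hr)))) ⟩
      ∑ ℓ (λ i → 𝟙 (i <? r))        ∎)
      where open ≤-Reasoning

    -- The r rows below row r already have second entries less than `w`; one more such entry would
    -- contradict `count-<`.
    second-≥ : ∀ {j} → r ≤ j → j < ℓ → w ≤ h j 1
    second-≥ {j} r≤j j<ℓ = ≮⇒≥ λ hj<w → <-irrefl (sym (count-< 1 ≤-refl)) (∑-mono-< ℓ j j<ℓ
      (subst₂ _<_ (sym (𝟙-no (j <? r) (≤⇒≯ r≤j))) (sym (𝟙-yes (h j 1 <? w) hj<w)) ≤-refl)
      (λ i i<ℓ → 𝟙-mono (i <? r) (h i 1 <? w)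
        (λ i<r → ≤-<-trans (H.row-step i<ℓ ≤-refl) (<-≤-trans (HP.col-strict i<r r<ℓ) head-≤))))

  evacuated-head : h r 0 ≡ w
  evacuated-head = ≤-antisym head-≤ head-≥

  evacuated-second : h r 1 ≡ w
  evacuated-second = ≤-antisym (≤-trans (H.row-step r<ℓ ≤-refl) head-≤) (second-≥ ≤-refl r<ℓ)

  evacuated-above : ∀ {j} → r < j → j < ℓ → h r 0 < h j 1
  evacuated-above {j} r<j j<ℓ = ≤∧≢⇒< (≤-trans head-≤ (second-≥ (<⇒≤ r<j) j<ℓ))
    (λ eq → HP.column-distinct-< 1 r<j j<ℓ ≤-refl ≤-refl (trans evacuated-second (trans (sym evacuated-head) eq)))

one-two-injection : ∀ {n ℓ a a′} → (∀ {r} → r < ℓ → OneOrTwo (a r)) → (∀ {r} → r < ℓ → OneOrTwo (a′ r)) →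
  (∀ r s → suc (r + s) ≡ ℓ → a′ r ≡ a s) → ComplementingInjection n ℓ a a′
one-two-injection {n} {ℓ} {a} {a′} a∈12 a′∈12 reversed = record
  { Related   = λ g h → Evacuation n ℓ 1 (double a g) h × DoubledRows ℓ a′ h
  ; image     = image
  ; injective = λ {g} {h} F G (E , dg′) (E′ , dh′) agree {r} {k} r<ℓ k<a →
      trans (sym (Agree-double a∈12 g r<ℓ k<a)) (trans
        (evacuation-injective (double-filling a∈12 F) (double-filling a∈12 G) E E′
          (DoubledRows-Agree a′∈12 dg′ dh′ agree) r<ℓ (<-≤-trans k<a (a≤2 r<ℓ)))
        (Agree-double a∈12 h r<ℓ k<a))
  }
  where
  a≤2 : ∀ {r} → r < ℓ → a r ≤ 2
  a≤2 r<ℓ = OneOrTwo-≤2 (a∈12 r<ℓ)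

  image : ∀ {g} → Filling ℓ a n g → ∃ λ h → Filling ℓ a′ n h ×
    (∀ v → v < n → occurrences ℓ a′ h (suc v) ≡ occurrences ℓ a g (n ∸ v)) ×
    Evacuation n ℓ 1 (double a g) h × DoubledRows ℓ a′ h
  image {g} G with h , H , E ← evacuate (double-filling a∈12 G) =
    h , undouble a′∈12 H above , occ , E , doubled
    where
    d : ℕ → ℕ → ℕ
    d = double a g
    D : Rectangle ℓ 1 n d
    D = double-filling a∈12 G
    module Opposite {r s} (index : suc (r + s) ≡ ℓ) (as≡1 : a s ≡ 1) where
      s<ℓ : s < ℓ
      s<ℓ = suc-sum-< s r (suc-sum-comm r s index)
      constant : d s 1 ≡ d s 0
      constant = DoubledRows-double a∈12 g s<ℓ as≡1
      head : h r 0 ≡ suc n ∸ d s 0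
      head = evacuated-head D H E index constant (above-doubled a∈12 G as≡1)
      second : h r 1 ≡ suc n ∸ d s 0
      second = evacuated-second D H E index constant (above-doubled a∈12 G as≡1)
      larger : ∀ {j} → r < j → j < ℓ → h r 0 < h j 1
      larger = evacuated-above D H E index constant (above-doubled a∈12 G as≡1)
    above : ∀ {r j} → a′ r ≡ 1 → r < j → j < ℓ → h r 0 < h j 1
    above {r} a′r≡1 r<j j<ℓ = let eq = m+[n∸m]≡n (<-trans r<j j<ℓ) in
      Opposite.larger eq (trans (sym (reversed r _ eq)) a′r≡1) r<j j<ℓ
    doubled : DoubledRows ℓ a′ h
    doubled {r} r<ℓ a′r≡1 = let eq = m+[n∸m]≡n r<ℓ ; as≡1 = trans (sym (reversed r _ eq)) a′r≡1 in
      trans (Opposite.second eq as≡1) (sym (Opposite.head eq as≡1))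
    extra : ∀ v → v < n → ∑ ℓ (λ r → 𝟙 (a′ r ≟ 1) * 𝟙 (suc v ≟ h r 0)) ≡
                          ∑ ℓ (λ r → 𝟙 (a r ≟ 1) * 𝟙 (n ∸ v ≟ d r 0))
    extra v v<n = ∑-reverse ℓ λ r s eq → trans
      (cong (λ x → 𝟙 (x ≟ 1) * 𝟙 (suc v ≟ h r 0)) (reversed r s eq))
      (𝟙*-cong (a s ≟ 1) λ as≡1 → trans
        (cong (λ x → 𝟙 (suc v ≟ x)) (Opposite.head eq as≡1))
        (𝟙-cong (suc v ≟ suc n ∸ d s 0) (n ∸ v ≟ d s 0)
          (≡-complement v<n (Filling.bounded D (suc-sum-< s r (suc-sum-comm r s eq)) z<s)) (complement-≡ v<n)))
    occ : ∀ v → v < n → occurrences ℓ a′ h (suc v) ≡ occurrences ℓ a g (n ∸ v)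
    occ v v<n = trans
      -- Contents are compared for the doubled rectangles. The extra copies on the two sides agree
      -- by `extra`, since opposite rows of length 1 have complementary heads, and cancel.
      (+-cancelʳ-≡ (∑ ℓ (λ r → 𝟙 (a r ≟ 1) * 𝟙 (n ∸ v ≟ d r 0))) _ _ (begin
        occurrences ℓ a′ h (suc v) + ∑ ℓ (λ r → 𝟙 (a r ≟ 1) * 𝟙 (n ∸ v ≟ d r 0))
          ≡⟨ cong (occurrences ℓ a′ h (suc v) +_) (extra v v<n) ⟨
        occurrences ℓ a′ h (suc v) + ∑ ℓ (λ r → 𝟙 (a′ r ≟ 1) * 𝟙 (suc v ≟ h r 0))
          ≡⟨ doubled-occurrences a′∈12 {h} doubled (suc v) ⟨
        occurrences ℓ (λ _ → 2) h (suc v)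
          ≡⟨ evacuation-occurrences D E v v<n ⟩
        occurrences ℓ (λ _ → 2) d (n ∸ v)
          ≡⟨ doubled-occurrences a∈12 (DoubledRows-double a∈12 g) (n ∸ v) ⟩
        occurrences ℓ a d (n ∸ v) + ∑ ℓ (λ r → 𝟙 (a r ≟ 1) * 𝟙 (n ∸ v ≟ d r 0)) ∎))
      (occurrences-cong ℓ a (n ∸ v) (Agree-double a∈12 g))
      where open ≡-Reasoning

-- Admissible shapes

Filling-shape : ∀ {ℓ a b n g} → (∀ {r} → r < ℓ → a r ≡ b r) → Filling ℓ a n g → Filling ℓ b n g
Filling-shape a≡b F = record
  { positive = λ r<ℓ k<b → positive r<ℓ (subst (_ <_) (sym (a≡b r<ℓ)) k<b)
  ; bounded  = λ r<ℓ k<b → bounded r<ℓ (subst (_ <_) (sym (a≡b r<ℓ)) k<b)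
  ; row-step = λ r<ℓ k<b → row-step r<ℓ (subst (_ <_) (sym (a≡b r<ℓ)) k<b)
  ; col-step = col-step
  ; typeA    = λ i<i′ i′<ℓ b≤b k<b → let i<ℓ = <-trans i<i′ i′<ℓ in
      typeA i<i′ i′<ℓ (subst₂ _≤_ (sym (a≡b i′<ℓ)) (sym (a≡b i<ℓ)) b≤b) (subst (_ <_) (sym (a≡b i′<ℓ)) k<b)
  ; typeB    = λ i<i′ i′<ℓ b<b k<b k<b′ → let i<ℓ = <-trans i<i′ i′<ℓ in
      typeB i<i′ i′<ℓ (subst₂ _<_ (sym (a≡b i<ℓ)) (sym (a≡b i′<ℓ)) b<b)
        (subst (_ <_) (sym (a≡b i<ℓ)) k<b) (subst (_ <_) (sym (a≡b i′<ℓ)) k<b′)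
  }
  where open Filling F

occurrences-shape : ∀ ℓ {a b} g v → (∀ {r} → r < ℓ → a r ≡ b r) → occurrences ℓ a g v ≡ occurrences ℓ b g v
occurrences-shape ℓ g v a≡b = ∑-cong ℓ (λ r r<ℓ → cong (λ m → ∑ m (λ k → 𝟙 (v ≟ g r k))) (a≡b r<ℓ))

injection-shape : ∀ {n ℓ a a′ b b′} → (∀ {r} → r < ℓ → a r ≡ b r) → (∀ {r} → r < ℓ → a′ r ≡ b′ r) →
  ComplementingInjection n ℓ a a′ → ComplementingInjection n ℓ b b′
injection-shape {n} {ℓ} {a} {a′} a≡b a′≡b′ I = record
  { Related   = Related
  ; image     = λ {g} F → let g′ , F′ , occ , R = image (back F) in
      g′ , Filling-shape a′≡b′ F′ , (λ v v<n → trans (sym (occurrences-shape ℓ g′ (suc v) a′≡b′))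
        (trans (occ v v<n) (occurrences-shape ℓ g (n ∸ v) a≡b))) , R
  ; injective = λ F G R R′ agree {r} {k} r<ℓ k<b →
      injective (back F) (back G) R R′ (λ {s} {m} s<ℓ m<a′ → agree s<ℓ (subst (m <_) (a′≡b′ s<ℓ) m<a′))
        r<ℓ (subst (k <_) (sym (a≡b r<ℓ)) k<b)
  }
  where
  open ComplementingInjection I
  back : ∀ {g} → Filling ℓ _ n g → Filling ℓ a n g
  back = Filling-shape (λ r<ℓ → sym (a≡b r<ℓ))

-- A positionwise form of the conditions that is stable under reversal: `saturated` bounds ascents
-- and descents separately because reversal exchanges them.
data Admissible (n : ℕ) (α : List ℕ) : Set where
  rectangular : ∀ m → (∀ {r} → r < length α → suc m ≡ at α r) → Admissible n α
  one-two     : (∀ {r} → r < length α → OneOrTwo (at α r)) → Admissible n α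
  saturated   : length α ≡ n → (∀ {r} → suc r < length α → at α (suc r) ≤ suc (at α r)) →
                (∀ {r} → suc r < length α → at α r ≤ suc (at α (suc r))) → Admissible n α

at-reverse-opposite : ∀ α {r} → r < length α →
  ∃ λ s → suc (r + s) ≡ length α × s < length α × at (reverse α) r ≡ at α s
at-reverse-opposite α {r} r<ℓ = s , eq , suc-sum-< s r (suc-sum-comm r s eq) , at-reverse α r s eq
  where
  s : ℕ
  s = length α ∸ suc r
  eq : suc (r + s) ≡ length α
  eq = m+[n∸m]≡n r<ℓ

at-reverse-adjacent : ∀ α {r} → suc r < length α → ∃ λ s → suc s < length α ×
  at (reverse α) r ≡ at α (suc s) × at (reverse α) (suc r) ≡ at α s
at-reverse-adjacent α {r} sr<ℓ with s , eq , _ , at≡ ← at-reverse-opposite α sr<ℓ =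
  s , suc-sum-< (suc s) r (suc-sum-comm r (suc s) eq′) , at-reverse α r (suc s) eq′ , at≡
  where
  eq′ : suc (r + suc s) ≡ length α
  eq′ = trans (cong suc (+-suc r s)) eq

reverse-< : ∀ (α : List ℕ) {r} → r < length (reverse α) → r < length α
reverse-< α = subst (_ <_) (length-reverse α)

reverse-Admissible : ∀ {n} α → Admissible n α → Admissible n (reverse α)
reverse-Admissible α (rectangular m same) = rectangular m λ r<ℓ →
  let _ , _ , s<ℓ , eq = at-reverse-opposite α (reverse-< α r<ℓ) in trans (same s<ℓ) (sym eq)
reverse-Admissible α (one-two h) = one-two λ r<ℓ →
  let _ , _ , s<ℓ , eq = at-reverse-opposite α (reverse-< α r<ℓ) in subst OneOrTwo (sym eq) (h s<ℓ)
reverse-Admissible α (saturated ℓ≡n up down) = saturated (trans (length-reverse α) ℓ≡n)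
  (λ sr<ℓ → let _ , ss<ℓ , eq , eq′ = at-reverse-adjacent α (reverse-< α sr<ℓ) in
     subst₂ _≤_ (sym eq′) (cong suc (sym eq)) (down ss<ℓ))
  (λ sr<ℓ → let _ , ss<ℓ , eq , eq′ = at-reverse-adjacent α (reverse-< α sr<ℓ) in
     subst₂ _≤_ (sym eq) (cong suc (sym eq′)) (up ss<ℓ))

admissible-injection : ∀ {n} α → IsComposition α → Admissible n α →
  ComplementingInjection n (length α) (at α) (at (reverse α))
admissible-injection {n} α _ (rectangular m same) =
  injection-shape same
    (λ r<ℓ → let _ , _ , s<ℓ , eq = at-reverse-opposite α r<ℓ in trans (same s<ℓ) (sym eq))
    (rectangle-injection n (length α) m)
admissible-injection α _ (one-two h) = one-two-injection h
  (λ r<ℓ → let _ , _ , s<ℓ , eq = at-reverse-opposite α r<ℓ in subst OneOrTwo (sym eq) (h s<ℓ))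
  (at-reverse α)
admissible-injection α comp (saturated refl up _) = rigid-injection (at-All comp) up (at-reverse α)

reverse-IsComposition : ∀ {α} → IsComposition α → IsComposition (reverse α)
reverse-IsComposition {α} = ↭P.All-resp-↭ (↭-sym (↭P.↭-reverse α))

-- The injection for α gives one inequality; the other is the injection for `reverse α` at the
-- reversed exponents, as both reversals are involutions.
YQS-≈-QS : ∀ {n} α → IsComposition α → Admissible n α → YQS α n ≈ₚ QS α n
YQS-≈-QS {n} α comp adm e = ≤-antisym
  (subst₂ (λ γ e′ → QS (reverse α) n (Vec.reverse e) ≤ QS γ n e′) (reverse-involutive α) (VecP.reverse-involutive e)
    (QS-reverse-≤ (reverse α) (Vec.reverse e) (subst IsComposition (sym (reverse-involutive α)) comp)
      (admissible-injection (reverse α) comp′ (reverse-Admissible α adm))))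
  (QS-reverse-≤ α e comp′ (admissible-injection α comp adm))
  where
  comp′ : IsComposition (reverse α)
  comp′ = reverse-IsComposition comp

-- Necessity of the conditions, and the equivalence

list-ext : ∀ α β → length α ≡ length β → (∀ {r} → r < length α → at α r ≡ at β r) → α ≡ β
list-ext []      []      _   _  = refl
list-ext (x ∷ α) (y ∷ β) len eq =
  cong₂ _∷_ (eq z<s) (list-ext α β (suc-injective len) (λ r<ℓ → eq (s<s r<ℓ)))

linked-from-at : ∀ {R : ℕ → ℕ → Set} α → (∀ {i} → suc i < length α → R (at α i) (at α (suc i))) → Linked R α
linked-from-at []          h = []
linked-from-at (x ∷ [])    h = [-]
linked-from-at (x ∷ y ∷ α) h = h (s<s z<s) ∷ linked-from-at (y ∷ α) (λ si<ℓ → h (s<s si<ℓ))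

linked-at : ∀ {R : ℕ → ℕ → Set} {α} → Linked R α → ∀ {i} → suc i < length α → R (at α i) (at α (suc i))
linked-at [-]          (s≤s ())
linked-at (Rxy ∷ _)    {zero}  _    = Rxy
linked-at (_ ∷ Rxs)    {suc i} si<ℓ = linked-at Rxs (s≤s⁻¹ si<ℓ)

OneOrTwo? : ∀ m → Dec (OneOrTwo m)
OneOrTwo? zero                = no λ ()
OneOrTwo? (suc zero)          = yes is1
OneOrTwo? (suc (suc zero))    = yes is2
OneOrTwo? (suc (suc (suc _))) = no λ ()

SameOrOneTwo : ℕ → ℕ → Set
SameOrOneTwo x y = x ≡ y ⊎ (OneOrTwo x × OneOrTwo y)

-- The first part decides: a part outside 1, 2 forces its neighbour to be equal to it, and a part 1
-- or 2 forces its neighbour to be 1 or 2.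
same-or-one-two : ∀ {α} → Linked SameOrOneTwo α → AllPartsSame α ⊎ AllPartsOneOrTwo α
same-or-one-two {[]}    _ = inj₂ []
same-or-one-two {x ∷ α} L with OneOrTwo? x
... | yes x∈12 = inj₂ (all12 x∈12 L)
  where
  all12 : ∀ {x α} → OneOrTwo x → Linked SameOrOneTwo (x ∷ α) → All OneOrTwo (x ∷ α)
  all12 x∈12 [-]                      = x∈12 ∷ []
  all12 x∈12 (inj₁ refl ∷ L)          = x∈12 ∷ all12 x∈12 L
  all12 x∈12 (inj₂ (_ , y∈12) ∷ L)    = x∈12 ∷ all12 y∈12 L
... | no  x∉12 = inj₁ λ p∈ q∈ → trans (sym (All.lookup (all-same x∉12 L) p∈)) (All.lookup (all-same x∉12 L) q∈)
  where
  all-same : ∀ {x α} → ¬ OneOrTwo x → Linked SameOrOneTwo (x ∷ α) → All (x ≡_) (x ∷ α)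
  all-same x∉12 [-]                   = refl ∷ []
  all-same x∉12 (inj₁ refl ∷ L)       = refl ∷ all-same x∉12 L
  all-same x∉12 (inj₂ (x∈12 , _) ∷ L) = contradiction x∈12 x∉12

YQS-≈-QS⇒dual : ∀ {n α β} → IsComposition α → IsComposition β → YQS α n ≈ₚ QS β n →
  Dual n (length β) (at β) (length α) (at (reverse α)) × Dual n (length α) (at (reverse α)) (length β) (at β)
YQS-≈-QS⇒dual {n} {α} {β} α-comp β-comp eq =
  subst (λ ℓ → Dual n (length β) (at β) ℓ (at (reverse α))) (length-reverse α)
    (dual-from-QS n β (reverse α) β-comp (λ e → subst (0 <_) (sym (eq e)))) ,
  subst (λ ℓ → Dual n ℓ (at (reverse α)) (length β) (at β)) (length-reverse α)
    (dual-from-QS n (reverse α) β (reverse-IsComposition α-comp) λ e →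
      subst (0 <_) (trans (cong (QS (reverse α) n) (sym (VecP.reverse-involutive e))) (eq (Vec.reverse e))))

at-reverse-positive : ∀ {α} → IsComposition α → ∀ {r} → r < length α → 0 < at (reverse α) r
at-reverse-positive {α} comp = reversed-positive (at-reverse α) (at-All comp)

at-reverse′ : ∀ α r s → suc (r + s) ≡ length α → at α r ≡ at (reverse α) s
at-reverse′ α r s eq = sym (at-reverse α s r (suc-sum-comm r s eq))

dual⇒≡ : ∀ {n α β} → IsComposition α → IsComposition β → length α ≤ n → length β ≤ n →
  Dual n (length β) (at β) (length α) (at (reverse α)) → Dual n (length α) (at (reverse α)) (length β) (at β) →
  α ≡ β
dual⇒≡ {α = α} {β} α-comp β-comp α≤n β≤n D D′
  with len , parts ← dual⇒reverse β≤n α≤n (at-All β-comp) (at-reverse-positive α-comp) D D′ =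
  list-ext α β (sym len) λ {r} r<ℓ → let rs = m+[n∸m]≡n r<ℓ in
    trans (at-reverse′ α r _ rs) (sym (parts r _ (trans rs (sym len))))

one-two-pair : ∀ {x y} → x < y → 0 < x → y ≤ suc x → ¬ (1 < x) → OneOrTwo x × OneOrTwo y
one-two-pair {suc (suc x)}                   _        _ _ ¬1<x = contradiction (s<s z<s) ¬1<x
one-two-pair {suc zero} {suc zero}           (s≤s ())
one-two-pair {suc zero} {suc (suc zero)}     _        _ _ _    = is1 , is2
one-two-pair {suc zero} {suc (suc (suc y))}  _        _ (s≤s (s≤s ()))

module Adjacent {n} α (comp : IsComposition α) (ℓ≤n : length α ≤ n)
  (D : Dual n (length α) (at α) (length α) (at (reverse α)))
  (D′ : Dual n (length α) (at (reverse α)) (length α) (at α))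
  {i} (si<ℓ : suc i < length α) where

  private
    ℓ : ℕ
    ℓ = length α

    a a′ : ℕ → ℕ
    a  = at α
    a′ = at (reverse α)

    a-pos : ∀ {r} → r < ℓ → 0 < a r
    a-pos = at-All comp

    a′-pos : ∀ {r} → r < ℓ → 0 < a′ r
    a′-pos = at-reverse-positive comp

    j : ℕ
    j = ℓ ∸ suc (suc i)

    sij : suc (suc i + j) ≡ ℓ
    sij = m+[n∸m]≡n si<ℓ

    isj : suc (i + suc j) ≡ ℓ
    isj = trans (cong suc (+-suc i j)) sij

    a′j : a′ j ≡ a (suc i)
    a′j = at-reverse α j (suc i) (suc-sum-comm (suc i) j sij)

    a′sj : a′ (suc j) ≡ a i
    a′sj = at-reverse α (suc j) i (suc-sum-comm i (suc j) isj)

  ascent≤1 : a (suc i) ≤ suc (a i)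
  ascent≤1 = ≮⇒≥ (no-large-ascent a-pos (at-reverse α) (suc-sum-comm (suc i) j sij) D ℓ≤n)

  -- A descent of α is an ascent of `reverse α`, to which the reverse duality `D′` applies.
  descent≤1 : a i ≤ suc (a (suc i))
  descent≤1 = ≮⇒≥ λ large → no-large-ascent a′-pos (at-reverse′ α) isj D′ ℓ≤n
    (subst₂ _<_ (cong suc (sym a′j)) (sym a′sj) large)

  -- With a spare variable, `no-descent-above-one`, applied to α or to its reverse, makes the
  -- smaller of two different adjacent parts equal to 1; the bound on ascents or descents makes the
  -- larger one 2.
  same-or-one-two-adjacent : ℓ < n → SameOrOneTwo (a i) (a (suc i))
  same-or-one-two-adjacent ℓ<n with <-cmp (a i) (a (suc i))
  ... | tri≈ _ ai≡asi _ = inj₁ ai≡asi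
  ... | tri< ai<asi _ _ = inj₂ (one-two-pair ai<asi (a-pos (<⇒≤ si<ℓ)) ascent≤1 λ 1<ai →
        no-descent-above-one a′-pos (at-reverse′ α) isj D′ ℓ<n (subst₂ _<_ (sym a′sj) (sym a′j) ai<asi)
          (subst (1 <_) (sym a′sj) 1<ai))
  ... | tri> _ _ asi<ai = inj₂ (Product.swap (one-two-pair asi<ai (a-pos si<ℓ) descent≤1
        (no-descent-above-one a-pos (at-reverse α) (suc-sum-comm (suc i) j sij) D ℓ<n asi<ai)))

PartsCondition : ℕ → List ℕ → Set
PartsCondition n α = AllPartsSame α ⊎ AllPartsOneOrTwo α ⊎ (n ≡ length α × ConsecutiveDiffAtMostOne α)

dual⇒parts-condition : ∀ {n} α → IsComposition α → length α ≤ n →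
  Dual n (length α) (at α) (length α) (at (reverse α)) → Dual n (length α) (at (reverse α)) (length α) (at α) →
  PartsCondition n α
dual⇒parts-condition α comp ℓ≤n D D′ with m≤n⇒m<n∨m≡n ℓ≤n
... | inj₁ ℓ<n  = Sum.map id inj₁
  (same-or-one-two (linked-from-at α (λ si<ℓ → Adjacent.same-or-one-two-adjacent α comp ℓ≤n D D′ si<ℓ ℓ<n)))
... | inj₂ refl = inj₂ (inj₂ (refl , linked-from-at α (λ si<ℓ →
  ≤-trans (Adjacent.descent≤1 α comp ℓ≤n D D′ si<ℓ) (≤-reflexive (sym (+-comm _ 1))) ,
  ≤-trans (Adjacent.ascent≤1 α comp ℓ≤n D D′ si<ℓ) (≤-reflexive (sym (+-comm _ 1))))))

admissible : ∀ {n α} → IsComposition α → PartsCondition n α → Admissible n α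
admissible {α = []}        _         (inj₁ same) = rectangular 0 λ ()
admissible {α = suc m ∷ α} _         (inj₁ same) = rectangular m λ r<ℓ → same (here refl) (at-∈ (suc m ∷ α) r<ℓ)
admissible {α = zero ∷ α}  (() ∷ _)  (inj₁ same)
admissible comp (inj₂ (inj₁ one-or-two))  = one-two (at-All one-or-two)
admissible comp (inj₂ (inj₂ (refl , L)))  = saturated refl
  (λ si<ℓ → ≤-trans (proj₂ (linked-at L si<ℓ)) (≤-reflexive (+-comm _ 1)))
  (λ si<ℓ → ≤-trans (proj₁ (linked-at L si<ℓ)) (≤-reflexive (+-comm _ 1)))

mainTheorem9 : (n : ℕ) (α β : List ℕ) →
    IsComposition α → IsComposition β → length α ≤ n → length β ≤ n →
    (YQS α n ≈ₚ QS β n) ⇔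
    (α ≡ β × (AllPartsSame α ⊎ AllPartsOneOrTwo α ⊎
    (n ≡ length α × ConsecutiveDiffAtMostOne α)))
mainTheorem9 n α β α-comp β-comp α≤n β≤n = mk⇔ to from
  where
  conclude : ∀ {β} → α ≡ β → Dual n (length β) (at β) (length α) (at (reverse α)) →
             Dual n (length α) (at (reverse α)) (length β) (at β) → α ≡ β × PartsCondition n α
  conclude refl D D′ = refl , dual⇒parts-condition α α-comp α≤n D D′
  to : YQS α n ≈ₚ QS β n → α ≡ β × PartsCondition n α
  to eq = let D , D′ = YQS-≈-QS⇒dual α-comp β-comp eq in
    conclude (dual⇒≡ α-comp β-comp α≤n β≤n D D′) D D′
  from : α ≡ β × PartsCondition n α → YQS α n ≈ₚ QS β n
  from (refl , condition) = YQS-≈-QS α α-comp (admissible α-comp condition)
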